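{- Let $m,n\ge 1$ and let $\lambda\subseteq\nu$ be partitions contained in the rectangle $(n-1)^{m-1}$. Then $\mathrm{PASM}(\nu/\lambda,m,n)$ is exactly the set of real $m\times n$ matrices $X=(X_{ij})$ satisfying all of the following: (1) $0\le \sum_{i'=1}^{i} X_{i'j}\le 1$ for all $1\le i\le m$, $1\le j\le n$; (2) $0\le \sum_{j'=1}^{j} X_{ij'}\le 1$ for all $1\le i\le m$, $1\le j\le n$; (3) $\sum_{i=1}^{m} X_{i1}=1$ and $\sum_{j=1}^{n} X_{1j}=1$; (4) $\sum_{j=1}^{n} X_{ij}=0$ for $2\le i\le m$, and $\sum_{i=1}^{m} X_{ij}=0$ for $2\le j\le n$; (5) $X_{ij}=0$ whenever $j\le\lambda_i$; (6) $X_{ij}=0$ whenever $i>1$ and $\nu_{i-1}+1<j\le n$, and $X_{1j}=0$ whenever $\nu_1+1<j\le n$.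
   Context: A partition $\mu=(\mu_1\ge\mu_2\ge\cdots)$ is a weakly decreasing sequence of nonnegative integers with finitely many nonzero terms; $\ell(\mu)$ denotes its number of positive parts. We identify $\mu$ with the set of matrix positions $\{(i,j): i\ge1,\ 1\le j\le\mu_i\}$. We write $\mu\subseteq\nu$ if $\mu_i\le\nu_i$ for all $i$, and $\mu\subseteq a^b$ (the $b\times a$ rectangle) if $\ell(\mu)\le b$ and $\mu_1\le a$. For a partition $\mu\subseteq(n-1)^{m-1}$, the $m\times n$ matrix $M^\mu=M^\mu(m,n)$ has entries: $M^\mu_{1,\mu_1+1}=1$; for each $1\le k\le m-1$ with $\mu_k>\mu_{k+1}$, $M^\mu_{k+1,\mu_{k+1}+1}=1$ and $M^\mu_{k+1,\mu_k+1}=-1$; all other entries are $0$. For partitions $\lambda\subseteq\nu\subseteq(n-1)^{m-1}$, $\mathrm{PASM}(\nu/\lambda,m,n)$ is the convex hull in $\mathbb{R}^{mn}$ of the matrices $M^\mu(m,n)$ over all partitions $\mu$ with $\lambda\subseteq\mu\subseteq\nu$. -}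

module Defs where

open import Algebra.Bundles.Raw using (RawMonoid)
import Algebra.Definitions.RawMonoid as RawMonoidDefinitions
open import Data.Bool.Base using (if_then_else_)
open import Data.Fin.Base as Fin using (Fin; toℕ; inject!)
open import Data.List.Base using (filter; length; upTo)
open import Data.Nat.Base as ℕ using (ℕ; zero; suc)
import Data.Nat.Properties as ℕ
open import Data.Product.Base using (Σ; ∃; ∃-syntax; Σ-syntax; _×_; _,_; proj₁; proj₂)
open import Data.Rational.Base
open import Data.Rational.Properties
open import Data.Rational.Solver using (module +-*-Solver)
open import Data.Vec.Functional using (Vector)
open import Level using (Level; 0ℓ)
open import Relation.Binary.PropositionalEquality
open import Relation.Nullary.Decidable.Core using (does)
open import Relation.Unary using (Pred; _∈_)

Cauchy : (ℕ → ℚ) → Set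
Cauchy x = ∀ ε → 0ℚ < ε →
  ∃[ N ] ∀ j k → N ℕ.≤ j → N ℕ.≤ k → ∣ x j - x k ∣ ≤ ε

-- Distinct Cauchy sequences may denote the same real: the equality of ℝ is
-- _≈ᵣ_ below, not _≡_.
record ℝ : Set where
  constructor mkℝ
  field
    approx : ℕ → ℚ
    cauchy : Cauchy approx

open ℝ public

infix 4 _≈ᵣ_ _≤ᵣ_

_≈ᵣ_ : ℝ → ℝ → Set
x ≈ᵣ y = ∀ ε → 0ℚ < ε →
  ∃[ N ] ∀ k → N ℕ.≤ k → ∣ approx x k - approx y k ∣ ≤ ε

_≤ᵣ_ : ℝ → ℝ → Set
x ≤ᵣ y = ∀ ε → 0ℚ < ε →
  ∃[ N ] ∀ k → N ℕ.≤ k → approx x k ≤ approx y k + ε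

∣x∣≤∣x-y∣+∣y∣ : ∀ x y → ∣ x ∣ ≤ ∣ x - y ∣ + ∣ y ∣
∣x∣≤∣x-y∣+∣y∣ x y = begin
  ∣ x ∣             ≡⟨ cong ∣_∣ (lemma x y) ⟩
  ∣ (x - y) + y ∣   ≤⟨ ∣p+q∣≤∣p∣+∣q∣ (x - y) y ⟩
  ∣ x - y ∣ + ∣ y ∣ ∎
  where
  open ≤-Reasoning
  open +-*-Solver
  lemma : ∀ x y → x ≡ (x - y) + y
  lemma = solve 2 (λ x y → x := (x :- y) :+ y) refl

interchange : ∀ a b c d → (a + b) - (c + d) ≡ (a - c) + (b - d)
interchange = solve 4 (λ a b c d → (a :+ b) :- (c :+ d) := (a :- c) :+ (b :- d)) refl
  where open +-*-Solver

∣a+b-[c+d]∣≤ : ∀ a b c d {δ} → ∣ a - c ∣ ≤ δ → ∣ b - d ∣ ≤ δ →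
  ∣ (a + b) - (c + d) ∣ ≤ δ + δ
∣a+b-[c+d]∣≤ a b c d {δ} ∣a-c∣≤δ ∣b-d∣≤δ = begin
  ∣ (a + b) - (c + d) ∣    ≡⟨ cong ∣_∣ (interchange a b c d) ⟩
  ∣ (a - c) + (b - d) ∣    ≤⟨ ∣p+q∣≤∣p∣+∣q∣ (a - c) (b - d) ⟩
  ∣ a - c ∣ + ∣ b - d ∣    ≤⟨ +-mono-≤ ∣a-c∣≤δ ∣b-d∣≤δ ⟩
  δ + δ                    ∎
  where open ≤-Reasoning

∣pq∣≤BC : ∀ {p q B C} → ∣ p ∣ ≤ B → ∣ q ∣ ≤ C → ∣ p * q ∣ ≤ B * C
∣pq∣≤BC {p} {q} {B} {C} ∣p∣≤B ∣q∣≤C = begin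
  ∣ p * q ∣     ≡⟨ ∣p*q∣≡∣p∣*∣q∣ p q ⟩
  ∣ p ∣ * ∣ q ∣ ≤⟨ *-monoʳ-≤-nonNeg ∣ q ∣ {{∣-∣-nonNeg q}} ∣p∣≤B ⟩
  B * ∣ q ∣     ≤⟨ *-monoˡ-≤-nonNeg B {{nonNegative (≤-trans (0≤∣p∣ p) ∣p∣≤B)}} ∣q∣≤C ⟩
  B * C         ∎
  where open ≤-Reasoning

∣ab-cd∣≤ : ∀ a b c d {B C δ} →
  ∣ a ∣ ≤ B → ∣ d ∣ ≤ C → ∣ a - c ∣ ≤ δ → ∣ b - d ∣ ≤ δ →
  ∣ a * b - c * d ∣ ≤ (B + C) * δ
∣ab-cd∣≤ a b c d {B} {C} {δ} ∣a∣≤B ∣d∣≤C ∣a-c∣≤δ ∣b-d∣≤δ = begin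
  ∣ a * b - c * d ∣                     ≡⟨ cong ∣_∣ (split a b c d) ⟩
  ∣ a * (b - d) + d * (a - c) ∣         ≤⟨ ∣p+q∣≤∣p∣+∣q∣ (a * (b - d)) (d * (a - c)) ⟩
  ∣ a * (b - d) ∣ + ∣ d * (a - c) ∣     ≤⟨ +-mono-≤ (∣pq∣≤BC {a} {b - d} ∣a∣≤B ∣b-d∣≤δ) (∣pq∣≤BC {d} {a - c} ∣d∣≤C ∣a-c∣≤δ) ⟩
  B * δ + C * δ                         ≡⟨ sym (*-distribʳ-+ δ B C) ⟩
  (B + C) * δ                           ∎
  where
  open ≤-Reasoning
  open +-*-Solver
  split : ∀ a b c d → a * b - c * d ≡ a * (b - d) + d * (a - c)
  split = solve 4 (λ a b c d → a :* b :- c :* d := a :* (b :- d) :+ d :* (a :- c)) refl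

divide : ∀ D ε → 0ℚ < D → 0ℚ < ε → Σ[ δ ∈ ℚ ] 0ℚ < δ × D * δ ≡ ε
divide D ε 0<D 0<ε =
    1/ D * ε
  , positive⁻¹ (1/ D * ε) {{pos*pos⇒pos (1/ D) {{1/pos⇒pos D}} ε {{positive 0<ε}}}}
  , trans (sym (*-assoc D (1/ D) ε)) (trans (cong (_* ε) (*-inverseʳ D)) (*-identityˡ ε))
  where
  instance
    D-pos : Positive D
    D-pos = positive 0<D
    D-nonZero : NonZero D
    D-nonZero = pos⇒nonZero D

halve : ∀ ε → 0ℚ < ε → Σ[ δ ∈ ℚ ] 0ℚ < δ × δ + δ ≡ ε
halve ε 0<ε =
    ½ * ε
  , positive⁻¹ (½ * ε) {{pos*pos⇒pos ½ ε {{positive 0<ε}}}}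
  , trans (sym (*-distribʳ-+ ε ½ ½)) (*-identityˡ ε)

eventually-bounded : ∀ {x} → Cauchy x →
  ∃[ N ] Σ[ B ∈ ℚ ] 0ℚ < B × (∀ k → N ℕ.≤ k → ∣ x k ∣ ≤ B)
eventually-bounded {x} cx =
  N , 1ℚ + ∣ x N ∣ , 0<B , λ k N≤k → begin
    ∣ x k ∣                ≤⟨ ∣x∣≤∣x-y∣+∣y∣ (x k) (x N) ⟩
    ∣ x k - x N ∣ + ∣ x N ∣ ≤⟨ +-monoˡ-≤ ∣ x N ∣ (proj₂ e k N N≤k ℕ.≤-refl) ⟩
    1ℚ + ∣ x N ∣           ∎
  where
  open ≤-Reasoning
  e = cx 1ℚ (positive⁻¹ 1ℚ)
  N = proj₁ e
  0<B : 0ℚ < 1ℚ + ∣ x N ∣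
  0<B = +-mono-<-≤ (positive⁻¹ 1ℚ) (0≤∣p∣ (x N))

-- Only the approximating sequences matter to _≈ᵣ_ and _≤ᵣ_, so these proofs
-- need never unfold.
abstract
  const-cauchy : ∀ q → Cauchy (λ _ → q)
  const-cauchy q ε 0<ε = 0 , λ _ _ _ _ →
    subst (_≤ ε) (sym (cong ∣_∣ (+-inverseʳ q))) (<⇒≤ 0<ε)

  +-cauchy : ∀ x y → Cauchy x → Cauchy y → Cauchy (λ k → x k + y k)
  +-cauchy x y cx cy ε 0<ε =
    let δ , 0<δ , δ+δ≡ε = halve ε 0<ε
        Nx , ex = cx δ 0<δ
        Ny , ey = cy δ 0<δ
    in Nx ℕ.⊔ Ny , λ j k N≤j N≤k →
      subst (∣ (x j + y j) - (x k + y k) ∣ ≤_) δ+δ≡ε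
        (∣a+b-[c+d]∣≤ (x j) (y j) (x k) (y k)
          (ex j k (ℕ.m⊔n≤o⇒m≤o Nx Ny N≤j) (ℕ.m⊔n≤o⇒m≤o Nx Ny N≤k))
          (ey j k (ℕ.m⊔n≤o⇒n≤o Nx Ny N≤j) (ℕ.m⊔n≤o⇒n≤o Nx Ny N≤k)))

  *-cauchy : ∀ x y → Cauchy x → Cauchy y → Cauchy (λ k → x k * y k)
  *-cauchy x y cx cy ε 0<ε =
    let Bx , B , 0<B , bx = eventually-bounded cx
        By , C , 0<C , by = eventually-bounded cy
        δ , 0<δ , [B+C]δ≡ε = divide (B + C) ε (+-mono-< 0<B 0<C) 0<ε
        Nx , ex = cx δ 0<δ
        Ny , ey = cy δ 0<δ
    in (Bx ℕ.⊔ By) ℕ.⊔ (Nx ℕ.⊔ Ny) , λ j k N≤j N≤k →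
      let B≤j = ℕ.m⊔n≤o⇒m≤o (Bx ℕ.⊔ By) (Nx ℕ.⊔ Ny) N≤j
          B≤k = ℕ.m⊔n≤o⇒m≤o (Bx ℕ.⊔ By) (Nx ℕ.⊔ Ny) N≤k
          M≤j = ℕ.m⊔n≤o⇒n≤o (Bx ℕ.⊔ By) (Nx ℕ.⊔ Ny) N≤j
          M≤k = ℕ.m⊔n≤o⇒n≤o (Bx ℕ.⊔ By) (Nx ℕ.⊔ Ny) N≤k
      in subst (∣ x j * y j - x k * y k ∣ ≤_) [B+C]δ≡ε
        (∣ab-cd∣≤ (x j) (y j) (x k) (y k)
          (bx j (ℕ.m⊔n≤o⇒m≤o Bx By B≤j))
          (by k (ℕ.m⊔n≤o⇒n≤o Bx By B≤k))
          (ex j k (ℕ.m⊔n≤o⇒m≤o Nx Ny M≤j) (ℕ.m⊔n≤o⇒m≤o Nx Ny M≤k))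
          (ey j k (ℕ.m⊔n≤o⇒n≤o Nx Ny M≤j) (ℕ.m⊔n≤o⇒n≤o Nx Ny M≤k)))

fromℚ : ℚ → ℝ
fromℚ q = mkℝ (λ _ → q) (const-cauchy q)

0ᵣ 1ᵣ -1ᵣ : ℝ
0ᵣ  = fromℚ 0ℚ
1ᵣ  = fromℚ 1ℚ
-1ᵣ = fromℚ (- 1ℚ)

infixl 6 _+ᵣ_
infixl 7 _*ᵣ_

_+ᵣ_ : ℝ → ℝ → ℝ
x +ᵣ y = mkℝ (λ k → approx x k + approx y k) (+-cauchy (approx x) (approx y) (cauchy x) (cauchy y))

_*ᵣ_ : ℝ → ℝ → ℝ
x *ᵣ y = mkℝ (λ k → approx x k * approx y k) (*-cauchy (approx x) (approx y) (cauchy x) (cauchy y))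

+ᵣ-rawMonoid : RawMonoid 0ℓ 0ℓ
+ᵣ-rawMonoid = record { Carrier = ℝ ; _≈_ = _≈ᵣ_ ; _∙_ = _+ᵣ_ ; ε = 0ᵣ }

open RawMonoidDefinitions +ᵣ-rawMonoid public using (sum)

-- Inclusive: the sum of f i′ over all i′ ≤ i.
sumUpTo : ∀ {k} → Vector ℝ k → Fin k → ℝ
sumUpTo f i = sum (λ i′ → f (inject! {i = Fin.suc i} i′))

Matrix : ℕ → ℕ → Set
Matrix m n = Fin m → Fin n → ℝ

ConvexHull : ∀ {m n} {ℓ : Level} → Pred (Matrix m n) ℓ → Pred (Matrix m n) ℓ
ConvexHull {m} {n} S X =
  ∃[ k ] Σ[ c ∈ Vector ℝ k ] Σ[ P ∈ Vector (Matrix m n) k ]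
    (∀ t → 0ᵣ ≤ᵣ c t) ×
    sum c ≈ᵣ 1ᵣ ×
    (∀ t → P t ∈ S) ×
    (∀ i j → X i j ≈ᵣ sum (λ t → c t *ᵣ P t i j))

-- Rows and columns are numbered from 0: part μ i is μ_{i+1}.
record Partition : Set where
  field
    part          : ℕ → ℕ
    decreasing    : ∀ i → part (suc i) ℕ.≤ part i
    finiteSupport : ∃[ N ] ∀ i → N ℕ.≤ i → part i ≡ 0

open Partition public

ℓ : Partition → ℕ
ℓ μ = length (filter (λ i → 0 ℕ.<? part μ i) (upTo (proj₁ (finiteSupport μ))))

infix 4 _⊆_

_⊆_ : Partition → Partition → Set
μ ⊆ ν = ∀ i → part μ i ℕ.≤ part ν i

-- InRectangle a b μ is μ ⊆ a^b: at most b positive parts, each at most a.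
InRectangle : ℕ → ℕ → Partition → Set
InRectangle a b μ = ℓ μ ℕ.≤ b × part μ 0 ℕ.≤ a

-- The 1-indexed column μ_k + 1 is column part μ (k - 1) when counted from 0.
entry : Partition → ℕ → ℕ → ℝ
entry μ zero    j = if does (j ℕ.≟ part μ 0) then 1ᵣ else 0ᵣ
entry μ (suc k) j =
  if does (part μ (suc k) ℕ.<? part μ k)
  then (if does (j ℕ.≟ part μ (suc k)) then 1ᵣ
        else if does (j ℕ.≟ part μ k) then -1ᵣ
        else 0ᵣ)
  else 0ᵣ

partitionMatrix : Partition → (m n : ℕ) → Matrix m n
partitionMatrix μ m n i j = entry μ (toℕ i) (toℕ j)

PASM : Partition → Partition → (m n : ℕ) → Pred (Matrix m n) 0ℓ
PASM λ′ ν m n = ConvexHull λ X →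
  ∃[ μ ] λ′ ⊆ μ × μ ⊆ ν × (∀ i j → X i j ≈ᵣ partitionMatrix μ m n i j)

{-# OPTIONS --safe #-}

-- The partial sums F i j over rows up to i and columns up to j turn the
-- conditions into: 0 ≤ F ≤ 1, F is monotone in both indices, F i j = 0 for
-- j < λᵢ and F i j = 1 for j ≥ νᵢ (columns counted from 0).  For the matrix of
-- a partition μ, F i j is 1 if μᵢ ≤ j and 0 otherwise.  So a matrix X
-- satisfying the conditions is a point of an order polytope, and it is the
-- average over a threshold θ ∈ [0, 1] of the matrices whose partial sums are
-- the indicators of {θ < F}.  The coefficient of a subset U of the positions
-- is the length of {θ : {θ < F} = U}, the positive part of
-- min (1, F on U) − max (0, F off U).  Only max and min enter, so no
-- comparison of reals has to be decided.

module Submission where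

-- The familiar way to write a point of an order polytope as a convex combination sorts its
-- coordinates and uses the chain of their upper level sets. Sorting decides comparisons, so here
-- the combination runs over all `2 ^ N` subsets of the `N` positions. A subset that is not of the
-- form `{(i, j) : μ_i ≤ j}` with `λ′ ⊆ μ ⊆ ν` conflicts with a property of `F`, which forces its
-- coefficient to be 0; whether it is of this form is a question about Booleans and natural numbers,
-- hence decidable. A subset with coefficient 0 still needs a matrix and gets that of `λ′`. That the
-- coefficients add up correctly rests on one identity: a point `x` cuts the interval from `a` to
-- `b` into those from `a` to `min b x` and from `max a x` to `b`, where a reversed interval has
-- length 0. Applied at one position after another, it distributes `[0, 1]` over all subsets; the
-- subsets that contain a given position receive the part below the value of `F` there. The entries
-- are recovered from the partial sums by a difference in each index, and differences commute with
-- averaging.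

open import Defs
import Algebra.Properties.Semiring.Sum as SemiringSum
import Data.Bool.Properties as Bool
import Data.Nat.Properties as ℕ
import Data.Rational.Properties as ℚ
import Relation.Binary.Reasoning.Setoid as SetoidReasoning
open import Algebra.Bundles using (CommutativeSemiring)
open import Algebra.Structures using (IsCommutativeSemiring)
open import Algebra.Structures.Biased using (isCommutativeSemiringˡ)
open import Data.Bool.Base using (Bool; true; false; if_then_else_)
open import Data.Fin.Base using (Fin; zero; suc; toℕ; fromℕ<; Fin′; inject!; splitAt)
open import Data.Fin.Properties using (toℕ<n; toℕ-fromℕ<)
open import Data.List.Base using (filter; length; applyUpTo)
open import Data.Nat.Base as ℕ using (ℕ; zero; suc; _∸_; _^_; _≤_; _<_; z≤n; s≤s; z<s; s<s)
open import Data.Nat.Divisibility.Core using (divides-refl)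
open import Data.Nat.DivMod using (_/_; _%_; m%n<n; m<n*o⇒m/o<n; [m+kn]%n≡m%n; m<n⇒m%n≡m; m<n⇒m/n≡0; m*n/n≡m; +-distrib-/-∣ʳ)
open import Data.Product.Base using (∃-syntax; Σ-syntax; _×_; _,_; proj₁; proj₂)
open import Data.Rational.Base as ℚ using (ℚ; 0ℚ; 1ℚ; ∣_∣)
open import Data.Rational.Solver using (module +-*-Solver)
open import Data.Sum.Base using (_⊎_; inj₁; inj₂)
open import Data.Sum.Properties using ([,]-map)
open import Data.Vec.Functional using (Vector; map; _++_; []; tail)
open import Function.Base using (_∘_; id)
open import Level using (0ℓ)
open import Relation.Binary.PropositionalEquality using (_≡_; _≢_; refl; sym; trans; cong; cong₂; subst)
open import Relation.Nullary using (Dec; yes; no; does; ¬_; contradiction)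
open import Relation.Nullary.Decidable using (dec-true; dec-false; _×-dec_; _⊎-dec_)
open import Relation.Unary using (_≐_)

-- _≈ᵣ_ and _≤ᵣ_ unfold to Π-types from which Agda cannot recover the two
-- reals; wrapping them in records makes unification work.
infix 4 _≈_ _≼_

record _≈_ (x y : ℝ) : Set where
  constructor ⟪_⟫
  field ≈⇒≈ᵣ : x ≈ᵣ y

record _≼_ (x y : ℝ) : Set where
  constructor ⟪_⟫
  field ≼⇒≤ᵣ : x ≤ᵣ y

open _≈_
open _≼_

-- Order and equality of Cauchy reals.

Eventually : (ℕ → Set) → Set
Eventually P = ∃[ N ] ∀ k → N ℕ.≤ k → P k

eventually₂ : {P Q R : ℕ → Set} → (∀ {k} → P k → Q k → R k) →
  Eventually P → Eventually Q → Eventually R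
eventually₂ f (M , p) (N , q) = M ℕ.⊔ N , λ k M⊔N≤k →
  f (p k (ℕ.m⊔n≤o⇒m≤o M N M⊔N≤k)) (q k (ℕ.m⊔n≤o⇒n≤o M N M⊔N≤k))

pointwise⇒≼ : ∀ {x y} → (∀ k → approx x k ℚ.≤ approx y k) → x ≼ y
pointwise⇒≼ {x} {y} x≤y = ⟪ (λ ε 0<ε → 0 , λ k _ →
  ℚ.≤-trans (x≤y k) (ℚ.≤-trans (ℚ.≤-reflexive (sym (ℚ.+-identityʳ _))) (ℚ.+-monoʳ-≤ (approx y k) (ℚ.<⇒≤ 0<ε)))) ⟫

≼-refl : ∀ {x} → x ≼ x
≼-refl = pointwise⇒≼ λ _ → ℚ.≤-refl

≼-trans : ∀ {x y z} → x ≼ y → y ≼ z → x ≼ z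
≼-trans {x} {y} {z} ⟪ x≤y ⟫ ⟪ y≤z ⟫ = ⟪ (λ ε 0<ε →
  let δ , 0<δ , δ+δ≡ε = halve ε 0<ε
  in eventually₂ (λ {k} p q → begin
       approx x k               ≤⟨ p ⟩
       approx y k ℚ.+ δ         ≤⟨ ℚ.+-monoˡ-≤ δ q ⟩
       approx z k ℚ.+ δ ℚ.+ δ   ≡⟨ ℚ.+-assoc (approx z k) δ δ ⟩
       approx z k ℚ.+ (δ ℚ.+ δ) ≡⟨ cong (approx z k ℚ.+_) δ+δ≡ε ⟩
       approx z k ℚ.+ ε         ∎) (x≤y δ 0<δ) (y≤z δ 0<δ)) ⟫
  where open ℚ.≤-Reasoning

p-q≤r⇒p≤q+r : ∀ {p} q {r} → p ℚ.- q ℚ.≤ r → p ℚ.≤ q ℚ.+ r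
p-q≤r⇒p≤q+r {p} q {r} p-q≤r = begin
  p                 ≡⟨ lemma p q ⟩
  q ℚ.+ (p ℚ.- q)   ≤⟨ ℚ.+-monoʳ-≤ q p-q≤r ⟩
  q ℚ.+ r           ∎
  where
  open ℚ.≤-Reasoning
  open +-*-Solver
  lemma : ∀ p q → p ≡ q ℚ.+ (p ℚ.- q)
  lemma = solve 2 (λ p q → p := q :+ (p :- q)) refl

p≤q+r⇒p-q≤r : ∀ {p} q {r} → p ℚ.≤ q ℚ.+ r → p ℚ.- q ℚ.≤ r
p≤q+r⇒p-q≤r {p} q {r} p≤q+r = begin
  p ℚ.- q             ≤⟨ ℚ.+-monoˡ-≤ (ℚ.- q) p≤q+r ⟩
  q ℚ.+ r ℚ.- q       ≡⟨ lemma q r ⟩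
  r                   ∎
  where
  open ℚ.≤-Reasoning
  open +-*-Solver
  lemma : ∀ q r → q ℚ.+ r ℚ.- q ≡ r
  lemma = solve 2 (λ q r → q :+ r :- q := r) refl

p≤∣p∣ : ∀ p → p ℚ.≤ ∣ p ∣
p≤∣p∣ p with ℚ.≤-total 0ℚ p
... | inj₁ 0≤p = ℚ.≤-reflexive (sym (ℚ.0≤p⇒∣p∣≡p 0≤p))
... | inj₂ p≤0 = ℚ.≤-trans p≤0 (ℚ.0≤∣p∣ p)

-[p-q]≡q-p : ∀ p q → ℚ.- (p ℚ.- q) ≡ q ℚ.- p
-[p-q]≡q-p = solve 2 (λ p q → :- (p :- q) := q :- p) refl
  where open +-*-Solver

∣p-q∣≡∣q-p∣ : ∀ p q → ∣ p ℚ.- q ∣ ≡ ∣ q ℚ.- p ∣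
∣p-q∣≡∣q-p∣ p q = trans (sym (ℚ.∣-p∣≡∣p∣ (p ℚ.- q))) (cong ∣_∣ (-[p-q]≡q-p p q))

p≤q+∣p-q∣ : ∀ p q → p ℚ.≤ q ℚ.+ ∣ p ℚ.- q ∣
p≤q+∣p-q∣ p q = p-q≤r⇒p≤q+r q (p≤∣p∣ (p ℚ.- q))

∣p-q∣≤r : ∀ {p q r} → p ℚ.≤ q ℚ.+ r → q ℚ.≤ p ℚ.+ r → ∣ p ℚ.- q ∣ ℚ.≤ r
∣p-q∣≤r {p} {q} {r} p≤q+r q≤p+r with ℚ.∣p∣≡p∨∣p∣≡-p (p ℚ.- q)
... | inj₁ eq = ℚ.≤-trans (ℚ.≤-reflexive eq) (p≤q+r⇒p-q≤r q p≤q+r)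
... | inj₂ eq = ℚ.≤-trans (ℚ.≤-reflexive (trans eq (-[p-q]≡q-p p q))) (p≤q+r⇒p-q≤r p q≤p+r)

≈⇒≼ : ∀ {x y} → x ≈ y → x ≼ y
≈⇒≼ {x} {y} ⟪ x≈y ⟫ = ⟪ (λ ε 0<ε → proj₁ (x≈y ε 0<ε) , λ k N≤k →
  ℚ.≤-trans (p≤q+∣p-q∣ (approx x k) (approx y k))
            (ℚ.+-monoʳ-≤ (approx y k) (proj₂ (x≈y ε 0<ε) k N≤k))) ⟫

≼-antisym : ∀ {x y} → x ≼ y → y ≼ x → x ≈ y
≼-antisym ⟪ x≤y ⟫ ⟪ y≤x ⟫ = ⟪ (λ ε 0<ε → eventually₂ ∣p-q∣≤r (x≤y ε 0<ε) (y≤x ε 0<ε)) ⟫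

≈-sym : ∀ {x y} → x ≈ y → y ≈ x
≈-sym {x} {y} ⟪ x≈y ⟫ = ⟪ (λ ε 0<ε → proj₁ (x≈y ε 0<ε) , λ k N≤k →
  subst (ℚ._≤ ε) (∣p-q∣≡∣q-p∣ (approx x k) (approx y k)) (proj₂ (x≈y ε 0<ε) k N≤k)) ⟫

≈⇒≽ : ∀ {x y} → x ≈ y → y ≼ x
≈⇒≽ x≈y = ≈⇒≼ (≈-sym x≈y)

pointwise⇒≈ : ∀ {x y} → (∀ k → approx x k ≡ approx y k) → x ≈ y
pointwise⇒≈ x≡y = ≼-antisym (pointwise⇒≼ λ k → ℚ.≤-reflexive (x≡y k))
                            (pointwise⇒≼ λ k → ℚ.≤-reflexive (sym (x≡y k)))

≈-refl : ∀ {x} → x ≈ x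
≈-refl = pointwise⇒≈ λ _ → refl

≈-trans : ∀ {x y z} → x ≈ y → y ≈ z → x ≈ z
≈-trans x≈y y≈z = ≼-antisym (≼-trans (≈⇒≼ x≈y) (≈⇒≼ y≈z)) (≼-trans (≈⇒≽ y≈z) (≈⇒≽ x≈y))

-- Arithmetic and lattice operations on the reals.

-- The hypothesis is a one-sided Lipschitz bound with constant 1 in the maximum norm. Used in both
-- directions, it lets the tolerance `ε` of the arguments serve for the value as well.
lift₂ : (f : ℚ → ℚ → ℚ) →
  (∀ {a b} c d {r} → a ℚ.≤ c ℚ.+ r → b ℚ.≤ d ℚ.+ r → f a b ℚ.≤ f c d ℚ.+ r) →
  ℝ → ℝ → ℝ
lift₂ f f-mono x y = mkℝ (λ k → f (approx x k) (approx y k)) λ ε 0<ε →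
  let M , ex = cauchy x ε 0<ε
      N , ey = cauchy y ε 0<ε
      bound = λ j k M⊔N≤j M⊔N≤k → f-mono (approx x k) (approx y k)
        (ℚ.≤-trans (p≤q+∣p-q∣ (approx x j) (approx x k)) (ℚ.+-monoʳ-≤ (approx x k)
           (ex j k (ℕ.m⊔n≤o⇒m≤o M N M⊔N≤j) (ℕ.m⊔n≤o⇒m≤o M N M⊔N≤k))))
        (ℚ.≤-trans (p≤q+∣p-q∣ (approx y j) (approx y k)) (ℚ.+-monoʳ-≤ (approx y k)
           (ey j k (ℕ.m⊔n≤o⇒n≤o M N M⊔N≤j) (ℕ.m⊔n≤o⇒n≤o M N M⊔N≤k))))
  in M ℕ.⊔ N , λ j k N≤j N≤k → ∣p-q∣≤r (bound j k N≤j N≤k) (bound k j N≤k N≤j)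

⊔-mono-+ : ∀ {a b} c d {r} → a ℚ.≤ c ℚ.+ r → b ℚ.≤ d ℚ.+ r → a ℚ.⊔ b ℚ.≤ (c ℚ.⊔ d) ℚ.+ r
⊔-mono-+ c d {r} a≤c+r b≤d+r = ℚ.⊔-lub
  (ℚ.≤-trans a≤c+r (ℚ.+-monoˡ-≤ r (ℚ.p≤p⊔q c d)))
  (ℚ.≤-trans b≤d+r (ℚ.+-monoˡ-≤ r (ℚ.p≤q⊔p c d)))

⊓-mono-+ : ∀ {a b} c d {r} → a ℚ.≤ c ℚ.+ r → b ℚ.≤ d ℚ.+ r → a ℚ.⊓ b ℚ.≤ (c ℚ.⊓ d) ℚ.+ r
⊓-mono-+ {a} {b} c d {r} a≤c+r b≤d+r with ℚ.⊓-sel c d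
... | inj₁ eq = ℚ.≤-trans (ℚ.p⊓q≤p a b) (subst (λ z → a ℚ.≤ z ℚ.+ r) (sym eq) a≤c+r)
... | inj₂ eq = ℚ.≤-trans (ℚ.p⊓q≤q a b) (subst (λ z → b ℚ.≤ z ℚ.+ r) (sym eq) b≤d+r)

infixl 6 _+_ _-_ _⊔_
infixl 7 _*_ _⊓_

-- Transparent operations would make unification compare normal forms of
-- rational expressions, which is prohibitively slow.
opaque
  _+_ _*_ _-_ _⊔_ _⊓_ : ℝ → ℝ → ℝ
  _+_ = _+ᵣ_
  _*_ = _*ᵣ_
  x - y = x + -1ᵣ * y
  _⊔_ = lift₂ ℚ._⊔_ ⊔-mono-+
  _⊓_ = lift₂ ℚ._⊓_ ⊓-mono-+

  approx-+ : ∀ x y k → approx (x + y) k ≡ approx x k ℚ.+ approx y k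
  approx-+ x y k = refl

  approx-- : ∀ x y k → approx (x - y) k ≡ approx x k ℚ.- approx y k
  approx-- x y k = cong (approx x k ℚ.+_)
    (trans (sym (ℚ.neg-distribˡ-* 1ℚ (approx y k))) (cong ℚ.-_ (ℚ.*-identityˡ (approx y k))))

  approx-⊔ : ∀ x y k → approx (x ⊔ y) k ≡ approx x k ℚ.⊔ approx y k
  approx-⊔ x y k = refl

  approx-⊓ : ∀ x y k → approx (x ⊓ y) k ≡ approx x k ℚ.⊓ approx y k
  approx-⊓ x y k = refl

  *ᵣ≡* : ∀ x y → x *ᵣ y ≡ x * y
  *ᵣ≡* x y = refl

  +-mono-≼ : ∀ {x y u v} → x ≼ y → u ≼ v → x + u ≼ y + v
  +-mono-≼ {x} {y} {u} {v} ⟪ x≤y ⟫ ⟪ u≤v ⟫ = ⟪ (λ ε 0<ε →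
    let δ , 0<δ , δ+δ≡ε = halve ε 0<ε
    in eventually₂ (λ {k} p q → begin
         approx x k ℚ.+ approx u k                   ≤⟨ ℚ.+-mono-≤ p q ⟩
         (approx y k ℚ.+ δ) ℚ.+ (approx v k ℚ.+ δ)   ≡⟨ medial (approx y k) (approx v k) δ ⟩
         (approx y k ℚ.+ approx v k) ℚ.+ (δ ℚ.+ δ)   ≡⟨ cong (approx y k ℚ.+ approx v k ℚ.+_) δ+δ≡ε ⟩
         (approx y k ℚ.+ approx v k) ℚ.+ ε           ∎) (x≤y δ 0<δ) (u≤v δ 0<δ)) ⟫
    where
    open ℚ.≤-Reasoning
    open +-*-Solver
    medial : ∀ a b d → (a ℚ.+ d) ℚ.+ (b ℚ.+ d) ≡ (a ℚ.+ b) ℚ.+ (d ℚ.+ d)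
    medial = solve 3 (λ a b d → (a :+ d) :+ (b :+ d) := (a :+ b) :+ (d :+ d)) refl

  +-cong : ∀ {x y u v} → x ≈ y → u ≈ v → x + u ≈ y + v
  +-cong x≈y u≈v = ≼-antisym (+-mono-≼ (≈⇒≼ x≈y) (≈⇒≼ u≈v)) (+-mono-≼ (≈⇒≽ x≈y) (≈⇒≽ u≈v))

  -- Since `xu - yv = x(u - v) + v(x - y)`, bounds for `x` and `v` are enough.
  *-cong : ∀ {x y u v} → x ≈ y → u ≈ v → x * u ≈ y * v
  *-cong {x} {y} {u} {v} ⟪ x≈y ⟫ ⟪ u≈v ⟫ = ⟪ (λ ε 0<ε →
    let M , B , 0<B , x≤B = eventually-bounded (cauchy x)
        N , C , 0<C , v≤C = eventually-bounded (cauchy v)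
        δ , 0<δ , [B+C]δ≡ε = divide (B ℚ.+ C) ε (ℚ.+-mono-< 0<B 0<C) 0<ε
    in eventually₂
         (λ {k} (∣x∣≤B , ∣v∣≤C) (∣x-y∣≤δ , ∣u-v∣≤δ) →
            subst (∣ approx x k ℚ.* approx u k ℚ.- approx y k ℚ.* approx v k ∣ ℚ.≤_) [B+C]δ≡ε
              (∣ab-cd∣≤ (approx x k) (approx u k) (approx y k) (approx v k) ∣x∣≤B ∣v∣≤C ∣x-y∣≤δ ∣u-v∣≤δ))
         (eventually₂ _,_ (M , x≤B) (N , v≤C))
         (eventually₂ _,_ (x≈y δ 0<δ) (u≈v δ 0<δ))) ⟫

  -‿monoˡ-≼ : ∀ {x y} z → x ≼ y → x - z ≼ y - z
  -‿monoˡ-≼ {x} {y} z x≤y = +-mono-≼ {x} {y} { -1ᵣ * z} { -1ᵣ * z} x≤y ≼-refl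

  -‿cong : ∀ {x y u v} → x ≈ y → u ≈ v → x - u ≈ y - v
  -‿cong {x} {y} {u} {v} x≈y u≈v =
    +-cong {x} {y} { -1ᵣ * u} { -1ᵣ * v} x≈y (*-cong { -1ᵣ } { -1ᵣ } {u} {v} ≈-refl u≈v)

  isCommutativeSemiring : IsCommutativeSemiring _≈_ _+_ _*_ 0ᵣ 1ᵣ
  isCommutativeSemiring = isCommutativeSemiringˡ record
    { +-isCommutativeMonoid = record
      { isMonoid = record
        { isSemigroup = record
          { isMagma = record
            { isEquivalence = record { refl = ≈-refl ; sym = ≈-sym ; trans = ≈-trans }
            ; ∙-cong = +-cong
            }
          ; assoc = λ x y z → pointwise⇒≈ λ k → ℚ.+-assoc (approx x k) (approx y k) (approx z k)
          }
        ; identity = (λ x → pointwise⇒≈ λ k → ℚ.+-identityˡ (approx x k))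
                   , (λ x → pointwise⇒≈ λ k → ℚ.+-identityʳ (approx x k))
        }
      ; comm = λ x y → pointwise⇒≈ λ k → ℚ.+-comm (approx x k) (approx y k)
      }
    ; *-isCommutativeMonoid = record
      { isMonoid = record
        { isSemigroup = record
          { isMagma = record
            { isEquivalence = record { refl = ≈-refl ; sym = ≈-sym ; trans = ≈-trans }
            ; ∙-cong = *-cong
            }
          ; assoc = λ x y z → pointwise⇒≈ λ k → ℚ.*-assoc (approx x k) (approx y k) (approx z k)
          }
        ; identity = (λ x → pointwise⇒≈ λ k → ℚ.*-identityˡ (approx x k))
                   , (λ x → pointwise⇒≈ λ k → ℚ.*-identityʳ (approx x k))
        }
      ; comm = λ x y → pointwise⇒≈ λ k → ℚ.*-comm (approx x k) (approx y k)
      }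
    ; distribʳ = λ z x y → pointwise⇒≈ λ k → ℚ.*-distribʳ-+ (approx z k) (approx x k) (approx y k)
    ; zeroˡ = λ x → pointwise⇒≈ λ k → ℚ.*-zeroˡ (approx x k)
    }

  ⊔-lub : ∀ {x y z} → x ≼ z → y ≼ z → x ⊔ y ≼ z
  ⊔-lub ⟪ x≤z ⟫ ⟪ y≤z ⟫ = ⟪ (λ ε 0<ε → eventually₂ ℚ.⊔-lub (x≤z ε 0<ε) (y≤z ε 0<ε)) ⟫

  ⊓-glb : ∀ {x y z} → z ≼ x → z ≼ y → z ≼ x ⊓ y
  ⊓-glb {x} {y} ⟪ z≤x ⟫ ⟪ z≤y ⟫ = ⟪ (λ ε 0<ε → eventually₂ (λ {k} p q →
    subst (_ ℚ.≤_) (sym (ℚ.mono-≤-distrib-⊓ (ℚ.+-monoˡ-≤ ε) (approx x k) (approx y k))) (ℚ.⊓-glb p q))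
    (z≤x ε 0<ε) (z≤y ε 0<ε)) ⟫

  x≼x⊔y : ∀ x y → x ≼ x ⊔ y
  x≼x⊔y x y = pointwise⇒≼ λ k → ℚ.p≤p⊔q (approx x k) (approx y k)

  y≼x⊔y : ∀ x y → y ≼ x ⊔ y
  y≼x⊔y x y = pointwise⇒≼ λ k → ℚ.p≤q⊔p (approx x k) (approx y k)

  x⊓y≼x : ∀ x y → x ⊓ y ≼ x
  x⊓y≼x x y = pointwise⇒≼ λ k → ℚ.p⊓q≤p (approx x k) (approx y k)

  x⊓y≼y : ∀ x y → x ⊓ y ≼ y
  x⊓y≼y x y = pointwise⇒≼ λ k → ℚ.p⊓q≤q (approx x k) (approx y k)

ℝ-commutativeSemiring : CommutativeSemiring 0ℓ 0ℓ
ℝ-commutativeSemiring = record { isCommutativeSemiring = isCommutativeSemiring }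

open CommutativeSemiring ℝ-commutativeSemiring
  using (setoid; +-identityˡ; +-identityʳ; +-congˡ; +-congʳ; +-assoc; +-comm;
         *-identityˡ; *-identityʳ; *-congˡ; *-congʳ; zeroˡ; zeroʳ; *-assoc; *-comm; distribˡ; distribʳ)
open SemiringSum (CommutativeSemiring.semiring ℝ-commutativeSemiring)
  using (sum-cong-≋; sum-cong-≗; sum-replicate-zero; ∑-comm; *-distribˡ-sum; *-distribʳ-sum)
  renaming (sum to ∑)

opaque
  unfolding _+_

  -- Bridge from the transparent sum of the statement to the sum over the opaque semiring, on which
  -- the algebraic laws are available.
  sum≡∑ : ∀ {n} (f : Vector ℝ n) → sum f ≡ ∑ f
  sum≡∑ f = refl

sum-zero : ∀ {n} (f : Vector ℝ n) → (∀ i → f i ≈ 0ᵣ) → ∑ f ≈ 0ᵣ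
sum-zero {n} f f≈0 = ≈-trans (sum-cong-≋ f≈0) (sum-replicate-zero n)

sum-++ : ∀ {A : Set} (f : A → ℝ) {m} (xs : Vector A m) {n} (ys : Vector A n) →
  ∑ (f ∘ (xs ++ ys)) ≈ ∑ (f ∘ xs) + ∑ (f ∘ ys)
sum-++ f {zero}  xs ys = ≈-sym (+-identityˡ _)
sum-++ f {suc m} xs ys = begin
  f (xs zero) + ∑ (λ i → f ((xs ++ ys) (suc i)))         ≡⟨ cong (f (xs zero) +_) (sum-cong-≗ λ i → cong f ([,]-map (splitAt m i))) ⟩
  f (xs zero) + ∑ (f ∘ (tail xs ++ ys))                  ≈⟨ +-congˡ (sum-++ f (tail xs) ys) ⟩
  f (xs zero) + (∑ (f ∘ tail xs) + ∑ (f ∘ ys))           ≈⟨ +-assoc _ _ _ ⟨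
  f (xs zero) + ∑ (f ∘ tail xs) + ∑ (f ∘ ys)             ∎
  where open SetoidReasoning setoid

-- Lengths of intervals of thresholds.

x-x≈0 : ∀ x → x - x ≈ 0ᵣ
x-x≈0 x = pointwise⇒≈ λ k → trans (approx-- x x k) (ℚ.+-inverseʳ (approx x k))

y-0≈y : ∀ y → y - 0ᵣ ≈ y
y-0≈y y = pointwise⇒≈ λ k → trans (approx-- y 0ᵣ k) (ℚ.+-identityʳ (approx y k))

-- The length of the interval from a to b, which is empty if b < a.
gap : ℝ → ℝ → ℝ
gap a b = 0ᵣ ⊔ (b - a)

0≼gap : ∀ a b → 0ᵣ ≼ gap a b
0≼gap a b = x≼x⊔y 0ᵣ (b - a)

gap-empty : ∀ {a b} → b ≼ a → gap a b ≈ 0ᵣ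
gap-empty {a} {b} b≤a = ≼-antisym
  (⊔-lub ≼-refl (≼-trans (-‿monoˡ-≼ a b≤a) (≈⇒≼ (x-x≈0 a))))
  (0≼gap a b)

gap-monoʳ : ∀ {a b c} → b ≼ c → gap a b ≼ gap a c
gap-monoʳ {a} {b} {c} b≤c = ⊔-lub (0≼gap a c) (≼-trans (-‿monoˡ-≼ a b≤c) (y≼x⊔y 0ᵣ (c - a)))

gap-congʳ : ∀ {a b c} → b ≈ c → gap a b ≈ gap a c
gap-congʳ b≈c = ≼-antisym (gap-monoʳ (≈⇒≼ b≈c)) (gap-monoʳ (≈⇒≽ b≈c))

⊓-swap≼ : ∀ x y z → x ⊓ y ⊓ z ≼ x ⊓ z ⊓ y
⊓-swap≼ x y z = ⊓-glb
  (⊓-glb (≼-trans (x⊓y≼x (x ⊓ y) z) (x⊓y≼x x y)) (x⊓y≼y (x ⊓ y) z))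
  (≼-trans (x⊓y≼x (x ⊓ y) z) (x⊓y≼y x y))

⊓-swap : ∀ x y z → x ⊓ y ⊓ z ≈ x ⊓ z ⊓ y
⊓-swap x y z = ≼-antisym (⊓-swap≼ x y z) (⊓-swap≼ x z y)

-- This turns the average back into `F`: the thresholds in `[0, 1]` below a value `x` of `F` fill an
-- interval of length `x`.
gap-unit : ∀ {x} → 0ᵣ ≼ x → x ≼ 1ᵣ → gap 0ᵣ (1ᵣ ⊓ x) ≈ x
gap-unit {x} 0≤x x≤1 = ≼-antisym
  (⊔-lub 0≤x (≼-trans (≈⇒≼ (y-0≈y _)) (x⊓y≼y 1ᵣ x)))
  (≼-trans (⊓-glb x≤1 ≼-refl) (≼-trans (≈⇒≽ (y-0≈y _)) (y≼x⊔y 0ᵣ (1ᵣ ⊓ x - 0ᵣ))))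

-- Cuts the interval at `x` into the thresholds below `x` and the others. No order among `a`, `b`,
-- `x` is given; the identity is exact on each rational approximation, where the cases can be
-- distinguished, and so passes to the reals.
gap-split : ∀ a b x → gap a (b ⊓ x) + gap (a ⊔ x) b ≈ gap a b
gap-split a b x = pointwise⇒≈ λ k →
  trans (approx-+ (gap a (b ⊓ x)) (gap (a ⊔ x) b) k)
    (trans (cong₂ ℚ._+_
              (trans (approx-gap a (b ⊓ x) k) (cong (gapℚ (approx a k)) (approx-⊓ b x k)))
              (trans (approx-gap (a ⊔ x) b k) (cong (λ c → gapℚ c (approx b k)) (approx-⊔ a x k))))
      (trans (split (approx a k) (approx b k) (approx x k)) (sym (approx-gap a b k))))
  where
  gapℚ : ℚ → ℚ → ℚ
  gapℚ a b = 0ℚ ℚ.⊔ (b ℚ.- a)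

  approx-gap : ∀ a b k → approx (gap a b) k ≡ gapℚ (approx a k) (approx b k)
  approx-gap a b k = trans (approx-⊔ 0ᵣ (b - a) k) (cong (0ℚ ℚ.⊔_) (approx-- b a k))

  open +-*-Solver
  telescope : ∀ a b x → (x ℚ.- a) ℚ.+ (b ℚ.- x) ≡ b ℚ.- a
  telescope = solve 3 (λ a b x → (x :- a) :+ (b :- x) := b :- a) refl

  empty : ∀ {a b} → b ℚ.≤ a → gapℚ a b ≡ 0ℚ
  empty {a} b≤a = ℚ.p≥q⇒p⊔q≡p (ℚ.≤-trans (ℚ.+-monoˡ-≤ _ b≤a) (ℚ.≤-reflexive (ℚ.+-inverseʳ a)))

  full : ∀ {a b} → a ℚ.≤ b → gapℚ a b ≡ b ℚ.- a
  full {a} a≤b = ℚ.p≤q⇒p⊔q≡q (ℚ.≤-trans (ℚ.≤-reflexive (sym (ℚ.+-inverseʳ a))) (ℚ.+-monoˡ-≤ _ a≤b))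

  split : ∀ a b x → gapℚ a (b ℚ.⊓ x) ℚ.+ gapℚ (a ℚ.⊔ x) b ≡ gapℚ a b
  split a b x with ℚ.≤-total x a | ℚ.≤-total x b
  ... | inj₁ x≤a | _ = trans (cong₂ ℚ._+_ (empty (ℚ.≤-trans (ℚ.p⊓q≤q b x) x≤a))
                                          (cong (λ c → gapℚ c b) (ℚ.p≥q⇒p⊔q≡p x≤a)))
                             (ℚ.+-identityˡ _)
  ... | inj₂ a≤x | inj₁ x≤b = trans
    (cong₂ ℚ._+_ (trans (cong (gapℚ a) (ℚ.p≥q⇒p⊓q≡q x≤b)) (full a≤x))
                 (trans (cong (λ c → gapℚ c b) (ℚ.p≤q⇒p⊔q≡q a≤x)) (full x≤b)))
    (trans (telescope a b x) (sym (full (ℚ.≤-trans a≤x x≤b))))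
  ... | inj₂ a≤x | inj₂ b≤x = trans (cong₂ ℚ._+_ (cong (gapℚ a) (ℚ.p≤q⇒p⊓q≡p b≤x))
                                                 (empty (ℚ.≤-trans b≤x (ℚ.p≤q⊔p a x))))
                                    (ℚ.+-identityʳ _)

-- Subsets of the positions and their weights.

⟦_⟧ : Bool → ℝ
⟦ u ⟧ = if u then 1ᵣ else 0ᵣ

infixr 5 _◂_

_◂_ : Bool → (ℕ → Bool) → ℕ → Bool
(c ◂ u) zero    = c
(c ◂ u) (suc p) = u p

-- The value true beyond N makes a partition read off from a subset vanish
-- below the last row of the matrix.
subsets : ∀ N → Vector (ℕ → Bool) (2 ^ N)
subsets zero    _ = λ _ → true
subsets (suc N) = map (true ◂_) (subsets N) ++ (map (false ◂_) (subsets N) ++ [])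

subsets-beyond : ∀ N t {p} → N ℕ.≤ p → subsets N t p ≡ true
subsets-beyond zero    t _ = refl
subsets-beyond (suc N) t {suc p} (ℕ.s≤s N≤p) with splitAt (2 ^ N) t
... | inj₁ s = subsets-beyond N s N≤p
... | inj₂ t′ with splitAt (2 ^ N) t′
...   | inj₁ s = subsets-beyond N s N≤p

-- The number `2 ^ suc N` unfolds to `2 ^ N + (2 ^ N + 0)`; the final `[]` in the enumeration
-- accounts for the last summand and contributes an empty sum.
sum-subsets : ∀ N (f : (ℕ → Bool) → ℝ) →
  ∑ (f ∘ subsets (suc N)) ≈ ∑ (λ t → f (true ◂ subsets N t)) + ∑ (λ t → f (false ◂ subsets N t))
sum-subsets N f = begin
  ∑ (f ∘ subsets (suc N))                        ≈⟨ sum-++ f (map (true ◂_) (subsets N)) _ ⟩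
  ins + ∑ (f ∘ (map (false ◂_) (subsets N) ++ [])) ≈⟨ +-congˡ (sum-++ f (map (false ◂_) (subsets N)) []) ⟩
  ins + (outs + 0ᵣ)                              ≈⟨ +-congˡ (+-identityʳ outs) ⟩
  ins + outs                                      ∎
  where
  open SetoidReasoning setoid
  ins  = ∑ (λ t → f (true ◂ subsets N t))
  outs = ∑ (λ t → f (false ◂ subsets N t))

-- The minimum of `b` and the values on `u`, and the maximum of `a` and the values off `u`. The
-- bound is an accumulator, so that deciding position 0 merely narrows the interval, in the shape of
-- `gap-split`.
hi lo : ℕ → (ℕ → Bool) → (ℕ → ℝ) → ℝ → ℝ
hi zero    u x b = b
hi (suc N) u x b = hi N (u ∘ suc) (x ∘ suc) (if u 0 then b ⊓ x 0 else b)
lo zero    u x a = a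
lo (suc N) u x a = lo N (u ∘ suc) (x ∘ suc) (if u 0 then a else a ⊔ x 0)

hi≼init : ∀ N u x b → hi N u x b ≼ b
hi≼init zero    u x b = ≼-refl
hi≼init (suc N) u x b with u 0
... | true  = ≼-trans (hi≼init N _ _ _) (x⊓y≼x b (x 0))
... | false = hi≼init N _ _ _

hi≼member : ∀ N u x b {p} → p ℕ.< N → u p ≡ true → hi N u x b ≼ x p
hi≼member (suc N) u x b {zero}  p<N u0 rewrite u0 = ≼-trans (hi≼init N _ _ _) (x⊓y≼y b (x 0))
hi≼member (suc N) u x b {suc p} (ℕ.s≤s p<N) up = hi≼member N _ _ _ p<N up

init≼lo : ∀ N u x a → a ≼ lo N u x a
init≼lo zero    u x a = ≼-refl
init≼lo (suc N) u x a with u 0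
... | true  = init≼lo N _ _ _
... | false = ≼-trans (x≼x⊔y a (x 0)) (init≼lo N _ _ _)

nonMember≼lo : ∀ N u x a {p} → p ℕ.< N → u p ≡ false → x p ≼ lo N u x a
nonMember≼lo (suc N) u x a {zero}  p<N u0 rewrite u0 = ≼-trans (y≼x⊔y a (x 0)) (init≼lo N _ _ _)
nonMember≼lo (suc N) u x a {suc p} (ℕ.s≤s p<N) up = nonMember≼lo N _ _ _ p<N up

-- The length of the set of thresholds θ in [a, b] for which
-- u = {p < N : θ < x p}.
weight : ℕ → (ℕ → ℝ) → ℝ → ℝ → (ℕ → Bool) → ℝ
weight N x a b u = gap (lo N u x a) (hi N u x b)

-- Position 0 cuts the interval at `x 0`: the lower piece goes to the subsets that contain it, the
-- upper piece to the others, and each piece is distributed further by induction.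
sum-weight : ∀ N x a b → ∑ (weight N x a b ∘ subsets N) ≈ gap a b
sum-weight zero    x a b = +-identityʳ _
sum-weight (suc N) x a b = begin
  ∑ (weight (suc N) x a b ∘ subsets (suc N))          ≈⟨ sum-subsets N (weight (suc N) x a b) ⟩
  ∑ (weight N (x ∘ suc) a (b ⊓ x 0) ∘ subsets N) +
  ∑ (weight N (x ∘ suc) (a ⊔ x 0) b ∘ subsets N)     ≈⟨ +-cong (sum-weight N _ _ _) (sum-weight N _ _ _) ⟩
  gap a (b ⊓ x 0) + gap (a ⊔ x 0) b                 ≈⟨ gap-split a b (x 0) ⟩
  gap a b                                              ∎
  where open SetoidReasoning setoid

-- For position 0 only the lower piece of the cut survives. For a later position, both pieces lose
-- what lies above `x (suc p)`; after the two minima are exchanged, they are the pieces of a cut at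
-- `x 0` of the already shortened interval.
sum-weight-member : ∀ N x a b {p} → p ℕ.< N →
  ∑ (λ t → weight N x a b (subsets N t) * ⟦ subsets N t p ⟧) ≈ gap a (b ⊓ x p)
sum-weight-member (suc N) x a b {zero} p<N = begin
  ∑ (λ t → w (subsets (suc N) t) * ⟦ subsets (suc N) t 0 ⟧)  ≈⟨ sum-subsets N (λ u → w u * ⟦ u 0 ⟧) ⟩
  ∑ (λ t → w (true ◂ subsets N t) * 1ᵣ) +
  ∑ (λ t → w (false ◂ subsets N t) * 0ᵣ)                     ≈⟨ +-cong (sum-cong-≋ {2 ^ N} λ t → *-identityʳ (w (true ◂ subsets N t))) (sum-zero {2 ^ N} _ λ t → zeroʳ (w (false ◂ subsets N t))) ⟩
  ∑ (weight N (x ∘ suc) a (b ⊓ x 0) ∘ subsets N) + 0ᵣ       ≈⟨ +-identityʳ _ ⟩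
  ∑ (weight N (x ∘ suc) a (b ⊓ x 0) ∘ subsets N)             ≈⟨ sum-weight N _ _ _ ⟩
  gap a (b ⊓ x 0)                                              ∎
  where
  open SetoidReasoning setoid
  w = weight (suc N) x a b
sum-weight-member (suc N) x a b {suc p} (ℕ.s≤s p<N) = begin
  ∑ (λ t → w (subsets (suc N) t) * ⟦ subsets (suc N) t (suc p) ⟧)  ≈⟨ sum-subsets N (λ u → w u * ⟦ u (suc p) ⟧) ⟩
  ∑ (λ t → weight N (x ∘ suc) a (b ⊓ x 0) (subsets N t) * ⟦ subsets N t p ⟧) +
  ∑ (λ t → weight N (x ∘ suc) (a ⊔ x 0) b (subsets N t) * ⟦ subsets N t p ⟧)
    ≈⟨ +-cong (sum-weight-member N _ _ _ p<N) (sum-weight-member N _ _ _ p<N) ⟩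
  gap a (b ⊓ x 0 ⊓ x (suc p)) + gap (a ⊔ x 0) (b ⊓ x (suc p))    ≈⟨ +-congʳ swap ⟩
  gap a (b ⊓ x (suc p) ⊓ x 0) + gap (a ⊔ x 0) (b ⊓ x (suc p))    ≈⟨ gap-split a (b ⊓ x (suc p)) (x 0) ⟩
  gap a (b ⊓ x (suc p))                                              ∎
  where
  open SetoidReasoning setoid
  w = weight (suc N) x a b
  swap : gap a (b ⊓ x 0 ⊓ x (suc p)) ≈ gap a (b ⊓ x (suc p) ⊓ x 0)
  swap = gap-congʳ (⊓-swap b (x 0) (x (suc p)))

-- No threshold `θ` satisfies both `θ < x p` and `x q ≤ θ`. This and the next two lemmas discard the
-- subsets that do not come from a partition between `λ′` and `ν`.
weight-member≼nonMember : ∀ N x a b u {p q} → p < N → q < N →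
  u p ≡ true → u q ≡ false → x p ≼ x q → weight N x a b u ≈ 0ᵣ
weight-member≼nonMember N x a b u p<N q<N up uq xp≼xq = gap-empty
  (≼-trans (hi≼member N u x b p<N up) (≼-trans xp≼xq (nonMember≼lo N u x a q<N uq)))

weight-member≼lower : ∀ N x a b u {p} → p < N → u p ≡ true → x p ≼ a → weight N x a b u ≈ 0ᵣ
weight-member≼lower N x a b u p<N up xp≼a = gap-empty
  (≼-trans (hi≼member N u x b p<N up) (≼-trans xp≼a (init≼lo N u x a)))

weight-upper≼nonMember : ∀ N x a b u {q} → q < N → u q ≡ false → b ≼ x q → weight N x a b u ≈ 0ᵣ
weight-upper≼nonMember N x a b u q<N uq b≼xq = gap-empty
  (≼-trans (hi≼init N u x b) (≼-trans b≼xq (nonMember≼lo N u x a q<N uq)))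

-- Differences and partial sums of sequences of reals.

0-1≈-1 : 0ᵣ - 1ᵣ ≈ -1ᵣ
0-1≈-1 = pointwise⇒≈ λ k → approx-- 0ᵣ 1ᵣ k

x+[y-x]≈y : ∀ x y → x + (y - x) ≈ y
x+[y-x]≈y x y = pointwise⇒≈ λ k →
  trans (approx-+ x (y - x) k) (trans (cong (approx x k ℚ.+_) (approx-- y x k)) (lemma (approx x k) (approx y k)))
  where
  open +-*-Solver
  lemma : ∀ p q → p ℚ.+ (q ℚ.- p) ≡ q
  lemma = solve 2 (λ p q → p :+ (q :- p) := q) refl

[x+y]-x≈y : ∀ x y → (x + y) - x ≈ y
[x+y]-x≈y x y = pointwise⇒≈ λ k →
  trans (approx-- (x + y) x k) (trans (cong (ℚ._- approx x k) (approx-+ x y k)) (lemma (approx x k) (approx y k)))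
  where
  open +-*-Solver
  lemma : ∀ p q → (p ℚ.+ q) ℚ.- p ≡ q
  lemma = solve 2 (λ p q → (p :+ q) :- p := q) refl

-‿interchange : ∀ x y z w → (x - y) - (z - w) ≈ (x - z) - (y - w)
-‿interchange x y z w = pointwise⇒≈ λ k →
  trans (unfold x y z w k) (trans (lemma (approx x k) (approx y k) (approx z k) (approx w k)) (sym (unfold x z y w k)))
  where
  unfold : ∀ x y z w k → approx ((x - y) - (z - w)) k ≡ (approx x k ℚ.- approx y k) ℚ.- (approx z k ℚ.- approx w k)
  unfold x y z w k = trans (approx-- (x - y) (z - w) k) (cong₂ ℚ._-_ (approx-- x y k) (approx-- z w k))
  open +-*-Solver
  lemma : ∀ p q r s → (p ℚ.- q) ℚ.- (r ℚ.- s) ≡ (p ℚ.- r) ℚ.- (q ℚ.- s)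
  lemma = solve 4 (λ p q r s → (p :- q) :- (r :- s) := (p :- r) :- (q :- s)) refl

*-distribˡ-- : ∀ x y z → x * (y - z) ≈ x * y - x * z
*-distribˡ-- x y z = begin
  x * (y - z)                            ≈⟨ [x+y]-x≈y (x * z) _ ⟨
  (x * z + x * (y - z)) - x * z          ≈⟨ -‿cong (distribˡ x z (y - z)) ≈-refl ⟨
  x * (z + (y - z)) - x * z              ≈⟨ -‿cong (*-congˡ (x+[y-x]≈y z y)) ≈-refl ⟩
  x * y - x * z                          ∎
  where open SetoidReasoning setoid

+-cancel-- : ∀ x y z w → (x + y) - (z + w) ≈ (x - z) + (y - w)
+-cancel-- x y z w = pointwise⇒≈ λ k →
  trans (trans (approx-- (x + y) (z + w) k) (cong₂ ℚ._-_ (approx-+ x y k) (approx-+ z w k)))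
    (trans (interchange (approx x k) (approx y k) (approx z k) (approx w k))
      (sym (trans (approx-+ (x - z) (y - w) k) (cong₂ ℚ._+_ (approx-- x z k) (approx-- y w k)))))

∑-distrib-- : ∀ {n} (f g : Vector ℝ n) → ∑ (λ i → f i - g i) ≈ ∑ f - ∑ g
∑-distrib-- {zero}  f g = ≈-sym (y-0≈y 0ᵣ)
∑-distrib-- {suc n} f g = ≈-trans (+-congˡ (∑-distrib-- (f ∘ suc) (g ∘ suc)))
                                  (≈-sym (+-cancel-- (f zero) (∑ (f ∘ suc)) (g zero) (∑ (g ∘ suc))))

∑-mono-≼ : ∀ {n} (f g : Vector ℝ n) → (∀ i → f i ≼ g i) → ∑ f ≼ ∑ g
∑-mono-≼ {zero}  f g f≼g = ≼-refl
∑-mono-≼ {suc n} f g f≼g = +-mono-≼ (f≼g zero) (∑-mono-≼ (f ∘ suc) (g ∘ suc) (f≼g ∘ suc))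

-- Splits off the last term, whereas the sum over `Fin` splits off the first, so that consecutive
-- partial sums differ by one term definitionally.
sumBelow : (ℕ → ℝ) → ℕ → ℝ
sumBelow f zero    = 0ᵣ
sumBelow f (suc n) = sumBelow f n + f n

sumBelow-cong : ∀ {f g} n → (∀ {i} → i < n → f i ≈ g i) → sumBelow f n ≈ sumBelow g n
sumBelow-cong zero    f≈g = ≈-refl
sumBelow-cong (suc n) f≈g = +-cong (sumBelow-cong n (f≈g ∘ ℕ.m<n⇒m<1+n)) (f≈g ℕ.≤-refl)

sumBelow-head : ∀ f n → sumBelow f (suc n) ≈ f 0 + sumBelow (f ∘ suc) n
sumBelow-head f zero    = +-comm _ _
sumBelow-head f (suc n) = ≈-trans (+-congʳ (sumBelow-head f n)) (+-assoc _ _ _)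

∑-toℕ : ∀ n f → ∑ {n} (f ∘ toℕ) ≈ sumBelow f n
∑-toℕ zero    f = ≈-refl
∑-toℕ (suc n) f = ≈-trans (+-congˡ (∑-toℕ n (f ∘ suc))) (≈-sym (sumBelow-head f n))

sumBelow-+ : ∀ f g n → sumBelow (λ i → f i + g i) n ≈ sumBelow f n + sumBelow g n
sumBelow-+ f g zero    = ≈-sym (+-identityˡ 0ᵣ)
sumBelow-+ f g (suc n) = begin
  sumBelow (λ i → f i + g i) n + (f n + g n)  ≈⟨ +-congʳ (sumBelow-+ f g n) ⟩
  sumBelow f n + sumBelow g n + (f n + g n)          ≈⟨ +-assoc _ _ _ ⟩
  sumBelow f n + (sumBelow g n + (f n + g n))        ≈⟨ +-congˡ (+-assoc _ _ _) ⟨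
  sumBelow f n + (sumBelow g n + f n + g n)          ≈⟨ +-congˡ (+-congʳ (+-comm _ _)) ⟩
  sumBelow f n + (f n + sumBelow g n + g n)          ≈⟨ +-congˡ (+-assoc _ _ _) ⟩
  sumBelow f n + (f n + (sumBelow g n + g n))        ≈⟨ +-assoc _ _ _ ⟨
  sumBelow f n + f n + (sumBelow g n + g n)          ∎
  where open SetoidReasoning setoid

sumBelow-0 : ∀ n → sumBelow (λ _ → 0ᵣ) n ≈ 0ᵣ
sumBelow-0 zero    = ≈-refl
sumBelow-0 (suc n) = ≈-trans (+-identityʳ _) (sumBelow-0 n)

sumBelow-comm : ∀ (f : ℕ → ℕ → ℝ) m n → sumBelow (λ i → sumBelow (f i) n) m ≈ sumBelow (λ j → sumBelow (λ i → f i j) m) n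
sumBelow-comm f zero    n = ≈-sym (sumBelow-0 n)
sumBelow-comm f (suc m) n = ≈-trans (+-congʳ (sumBelow-comm f m n)) (≈-sym (sumBelow-+ (λ j → sumBelow (λ i → f i j) m) (f m) n))

sumBelow-extend-≼ : ∀ f {a b} → a ≤ b → (∀ {i} → a ≤ i → i < b → 0ᵣ ≼ f i) → sumBelow f a ≼ sumBelow f b
sumBelow-extend-≼ f {a} a≤b = go (ℕ.≤⇒≤′ a≤b)
  where
  go : ∀ {b} → a ℕ.≤′ b → (∀ {i} → a ≤ i → i < b → 0ᵣ ≼ f i) → sumBelow f a ≼ sumBelow f b
  go ℕ.≤′-refl _ = ≼-refl
  go (ℕ.≤′-step a≤′b) 0≼f = ≼-trans (go a≤′b λ a≤i i<b → 0≼f a≤i (ℕ.m<n⇒m<1+n i<b))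
    (≼-trans (≈⇒≽ (+-identityʳ _)) (+-mono-≼ ≼-refl (0≼f (ℕ.≤′⇒≤ a≤′b) ℕ.≤-refl)))

sumBelow-extend-≈ : ∀ f {a b} → a ≤ b → (∀ {i} → a ≤ i → i < b → f i ≈ 0ᵣ) → sumBelow f a ≈ sumBelow f b
sumBelow-extend-≈ f {a} a≤b = go (ℕ.≤⇒≤′ a≤b)
  where
  go : ∀ {b} → a ℕ.≤′ b → (∀ {i} → a ≤ i → i < b → f i ≈ 0ᵣ) → sumBelow f a ≈ sumBelow f b
  go ℕ.≤′-refl _ = ≈-refl
  go (ℕ.≤′-step a≤′b) f≈0 = ≈-trans (go a≤′b λ a≤i i<b → f≈0 a≤i (ℕ.m<n⇒m<1+n i<b))
    (≈-trans (≈-sym (+-identityʳ _)) (+-congˡ (≈-sym (f≈0 (ℕ.≤′⇒≤ a≤′b) ℕ.≤-refl))))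

-- Backward difference of `g` continued by 0 before index 0. With this convention it is inverse to
-- the partial sums that include the last index.
Δ : (ℕ → ℝ) → ℕ → ℝ
Δ g zero    = g 0
Δ g (suc i) = g (suc i) - g i

Δ-cong : ∀ {f g} i → (∀ {k} → k ≤ i → f k ≈ g k) → Δ f i ≈ Δ g i
Δ-cong zero    f≈g = f≈g z≤n
Δ-cong (suc i) f≈g = -‿cong (f≈g ℕ.≤-refl) (f≈g (ℕ.n≤1+n i))

sumBelow-Δ : ∀ g n → sumBelow (Δ g) (suc n) ≈ g n
sumBelow-Δ g zero    = +-identityˡ (g 0)
sumBelow-Δ g (suc n) = ≈-trans (+-congʳ (sumBelow-Δ g n)) (x+[y-x]≈y (g n) (g (suc n)))

Δ-sumBelow : ∀ f i → Δ (sumBelow f ∘ suc) i ≈ f i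
Δ-sumBelow f zero    = +-identityˡ (f 0)
Δ-sumBelow f (suc i) = [x+y]-x≈y (sumBelow f (suc i)) (f (suc i))

Δ-comm : ∀ (f : ℕ → ℕ → ℝ) i j → Δ (λ i → Δ (f i) j) i ≈ Δ (λ j → Δ (λ i → f i j) i) j
Δ-comm f zero    zero    = ≈-refl
Δ-comm f zero    (suc j) = ≈-refl
Δ-comm f (suc i) zero    = ≈-refl
Δ-comm f (suc i) (suc j) = -‿interchange (f (suc i) (suc j)) (f (suc i) j) (f i (suc j)) (f i j)

∑-Δ : ∀ {n} (f : Fin n → ℕ → ℝ) i → ∑ (λ t → Δ (f t) i) ≈ Δ (λ i → ∑ (λ t → f t i)) i
∑-Δ f zero    = ≈-refl
∑-Δ f (suc i) = ∑-distrib-- (λ t → f t (suc i)) (λ t → f t i)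

*-Δ : ∀ c f i → c * Δ f i ≈ Δ (λ i → c * f i) i
*-Δ c f zero    = ≈-refl
*-Δ c f (suc i) = *-distribˡ-- c (f (suc i)) (f i)

-- The sum of the entries of the matrix of μ in rows up to i and columns up to j.
corner : Partition → ℕ → ℕ → ℝ
corner μ i j = ⟦ does (part μ i ℕ.≤? j) ⟧

-- Row and column sums of partition matrices.

Δ-threshold : ∀ a j → Δ (λ j → ⟦ does (a ℕ.≤? j) ⟧) j ≈ ⟦ does (j ℕ.≟ a) ⟧
Δ-threshold zero    zero    = ≈-refl
Δ-threshold (suc a) zero    = ≈-refl
Δ-threshold a (suc j) with a ℕ.≤? suc j | a ℕ.≤? j | suc j ℕ.≟ a
... | yes _  | yes a≤j | yes refl = contradiction a≤j ℕ.1+n≰n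
... | yes a≤ | yes a≤j | no j≢a
  rewrite dec-true (a ℕ.≤? suc j) a≤ | dec-true (a ℕ.≤? j) a≤j | dec-false (suc j ℕ.≟ a) j≢a = x-x≈0 1ᵣ
... | yes a≤ | no a≰j  | yes j≡a
  rewrite dec-true (a ℕ.≤? suc j) a≤ | dec-false (a ℕ.≤? j) a≰j | dec-true (suc j ℕ.≟ a) j≡a = y-0≈y 1ᵣ
... | yes a≤ | no a≰j  | no j≢a   = contradiction (ℕ.≤-antisym (ℕ.≰⇒> a≰j) a≤) j≢a
... | no a≰  | yes a≤j | _        = contradiction (ℕ.m≤n⇒m≤1+n a≤j) a≰
... | no a≰  | no _    | yes refl = contradiction ℕ.≤-refl a≰
... | no a≰  | no a≰j  | no j≢a
  rewrite dec-false (a ℕ.≤? suc j) a≰ | dec-false (a ℕ.≤? j) a≰j | dec-false (suc j ℕ.≟ a) j≢a = x-x≈0 0ᵣ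

-- A row of `corner` is a step from 0 to 1 at `part μ i`, so its difference is a unit vector.
-- Subtracting the unit vectors of adjacent rows gives the 1 and the -1 of the definition; if the
-- two parts agree they cancel, which is the case of a zero row.
entry≈ΔΔcorner : ∀ μ i j → entry μ i j ≈ Δ (λ i → Δ (corner μ i) j) i
entry≈ΔΔcorner μ zero    j = ≈-sym (Δ-threshold (part μ 0) j)
entry≈ΔΔcorner μ (suc k) j = ≈-trans jump
  (≈-sym (-‿cong (Δ-threshold (part μ (suc k)) j) (Δ-threshold (part μ k) j)))
  where
  jump : entry μ (suc k) j ≈ ⟦ does (j ℕ.≟ part μ (suc k)) ⟧ - ⟦ does (j ℕ.≟ part μ k) ⟧
  jump with part μ (suc k) ℕ.<? part μ k
  ... | no ≮ rewrite dec-false (part μ (suc k) ℕ.<? part μ k) ≮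
                   | ℕ.≤-antisym (decreasing μ k) (ℕ.≮⇒≥ ≮) = ≈-sym (x-x≈0 _)
  ... | yes < rewrite dec-true (part μ (suc k) ℕ.<? part μ k) < with j ℕ.≟ part μ (suc k) | j ℕ.≟ part μ k
  ...   | yes eq | yes eq′ = contradiction (trans (sym eq) eq′) (ℕ.<⇒≢ <)
  ...   | yes eq | no ≢
    rewrite dec-true (j ℕ.≟ part μ (suc k)) eq | dec-false (j ℕ.≟ part μ k) ≢ = ≈-sym (y-0≈y 1ᵣ)
  ...   | no ≢   | yes eq
    rewrite dec-false (j ℕ.≟ part μ (suc k)) ≢ | dec-true (j ℕ.≟ part μ k) eq = ≈-sym 0-1≈-1
  ...   | no ≢   | no ≢′
    rewrite dec-false (j ℕ.≟ part μ (suc k)) ≢ | dec-false (j ℕ.≟ part μ k) ≢′ = ≈-sym (x-x≈0 0ᵣ)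

entry-off : ∀ μ k {j} → j ≢ part μ (suc k) → j ≢ part μ k → entry μ (suc k) j ≈ 0ᵣ
entry-off μ k {j} j≢ j≢′ with does (part μ (suc k) ℕ.<? part μ k)
... | false = ≈-refl
... | true rewrite dec-false (j ℕ.≟ part μ (suc k)) j≢ | dec-false (j ℕ.≟ part μ k) j≢′ = ≈-refl

entry₀-off : ∀ μ {j} → j ≢ part μ 0 → entry μ 0 j ≈ 0ᵣ
entry₀-off μ {j} j≢ rewrite dec-false (j ℕ.≟ part μ 0) j≢ = ≈-refl

column-sum : ∀ μ i j → sumBelow (λ i → entry μ i j) (suc i) ≈ ⟦ does (j ℕ.≟ part μ i) ⟧
column-sum μ i j = begin
  sumBelow (λ i → entry μ i j) (suc i)                   ≈⟨ sumBelow-cong (suc i) (λ {i′} _ → entry≈ΔΔcorner μ i′ j) ⟩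
  sumBelow (Δ (λ i → Δ (corner μ i) j)) (suc i)          ≈⟨ sumBelow-Δ (λ i → Δ (corner μ i) j) i ⟩
  Δ (corner μ i) j                                ≈⟨ Δ-threshold (part μ i) j ⟩
  ⟦ does (j ℕ.≟ part μ i) ⟧                       ∎
  where open SetoidReasoning setoid

row-sum : ∀ μ i j → sumBelow (entry μ i) (suc j) ≈ Δ (λ i → corner μ i j) i
row-sum μ i j = begin
  sumBelow (entry μ i) (suc j)                           ≈⟨ sumBelow-cong (suc j) (λ {j′} _ → ≈-trans (entry≈ΔΔcorner μ i j′) (Δ-comm (corner μ) i j′)) ⟩
  sumBelow (Δ (λ j → Δ (λ i → corner μ i j) i)) (suc j)  ≈⟨ sumBelow-Δ (λ j → Δ (λ i → corner μ i j) i) j ⟩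
  Δ (λ i → corner μ i j) i                        ∎
  where open SetoidReasoning setoid

-- One row further down, the step of `corner` lies no further to the right, so the value in column
-- `j` can rise from 0 to 1 but not fall.
row-sum-bit : ∀ μ i j → ∃[ b ] sumBelow (entry μ i) (suc j) ≈ ⟦ b ⟧
row-sum-bit μ zero    j = _ , row-sum μ zero j
row-sum-bit μ (suc k) j = proj₁ bit , ≈-trans (row-sum μ (suc k) j) (proj₂ bit)
  where
  bit : ∃[ b ] Δ (λ i → corner μ i j) (suc k) ≈ ⟦ b ⟧
  bit with part μ (suc k) ℕ.≤? j | part μ k ℕ.≤? j
  ... | yes p | yes q
    rewrite dec-true (part μ (suc k) ℕ.≤? j) p | dec-true (part μ k ℕ.≤? j) q = false , x-x≈0 1ᵣ
  ... | yes p | no ¬q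
    rewrite dec-true (part μ (suc k) ℕ.≤? j) p | dec-false (part μ k ℕ.≤? j) ¬q = true , y-0≈y 1ᵣ
  ... | no ¬p | yes q = contradiction (ℕ.≤-trans (decreasing μ k) q) ¬p
  ... | no ¬p | no ¬q
    rewrite dec-false (part μ (suc k) ℕ.≤? j) ¬p | dec-false (part μ k ℕ.≤? j) ¬q = false , x-x≈0 0ᵣ

corner-full : ∀ μ i {j} → part μ i ≤ j → corner μ i j ≈ 1ᵣ
corner-full μ i {j} ≤j rewrite dec-true (part μ i ℕ.≤? j) ≤j = ≈-refl

part-antitone : ∀ μ {i j} → i ≤ j → part μ j ≤ part μ i
part-antitone μ {i} i≤j = go (ℕ.≤⇒≤′ i≤j)
  where
  go : ∀ {j} → i ℕ.≤′ j → part μ j ≤ part μ i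
  go ℕ.≤′-refl = ℕ.≤-refl
  go (ℕ.≤′-step i≤′j) = ℕ.≤-trans (decreasing μ _) (go i≤′j)

length-filter-positive : ∀ (f g : ℕ → ℕ) {b N} → b ≤ N → (∀ {i} → i < b → 0 < f (g i)) →
  b ≤ length (filter (λ i → 0 ℕ.<? f i) (applyUpTo g N))
length-filter-positive f g {zero}  b≤N 0<f = z≤n
length-filter-positive f g {suc b} {suc N} (s≤s b≤N) 0<f
  rewrite dec-true (0 ℕ.<? f (g 0)) (0<f z<s) = s≤s (length-filter-positive f (g ∘ suc) b≤N (0<f ∘ s<s))

-- `ℓ` counts positive parts. If part `b` were positive, then by monotonicity so would be all
-- `b + 1` parts up to it, and the count would exceed `b`.
part-beyond-ℓ : ∀ μ {b} → ℓ μ ≤ b → part μ b ≡ 0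
part-beyond-ℓ μ {b} ℓ≤b with part μ b in eq
... | zero  = refl
... | suc _ = contradiction (ℕ.≤-trans b<ℓ ℓ≤b) ℕ.1+n≰n
  where
  N = proj₁ (finiteSupport μ)
  0<part : 0 < part μ b
  0<part = subst (0 <_) (sym eq) z<s
  b<N : b < N
  b<N with b ℕ.<? N
  ... | yes b<N = b<N
  ... | no b≮N = contradiction (trans (sym eq) (proj₂ (finiteSupport μ) b (ℕ.≮⇒≥ b≮N))) λ ()
  b<ℓ : suc b ≤ ℓ μ
  b<ℓ = length-filter-positive (part μ) id b<N λ i≤b → ℕ.≤-trans 0<part (part-antitone μ (ℕ.≤-pred i≤b))

-- From the convex hull to the inequalities.

toℕ-inject! : ∀ {n} {i : Fin (suc n)} (k : Fin′ i) → toℕ (inject! k) ≡ toℕ k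
toℕ-inject! {suc n} {suc i} zero    = refl
toℕ-inject! {suc n} {suc i} (suc k) = cong suc (toℕ-inject! k)

∑-inject! : ∀ {n} (f : ℕ → ℝ) (i : Fin n) → ∑ (λ r → f (toℕ (inject! {i = suc i} r))) ≈ sumBelow f (suc (toℕ i))
∑-inject! f i = ≈-trans (sum-cong-≋ {suc (toℕ i)} (λ r → reflexive (cong f (toℕ-inject! {i = suc i} r))))
                        (∑-toℕ (suc (toℕ i)) f)
  where
  reflexive : ∀ {x y} → x ≡ y → x ≈ y
  reflexive refl = ≈-refl

average-const : ∀ {k} {c : Vector ℝ k} (v : Vector ℝ k) {x} → ∑ c ≈ 1ᵣ → (∀ t → v t ≈ x) → ∑ (λ t → c t * v t) ≈ x
average-const {k} {c} v {x} ∑c≈1 v≈x = begin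
  ∑ (λ t → c t * v t) ≈⟨ sum-cong-≋ (λ t → *-congˡ (v≈x t)) ⟩
  ∑ (λ t → c t * x)   ≈⟨ *-distribʳ-sum x c ⟨
  ∑ c * x             ≈⟨ *-congʳ ∑c≈1 ⟩
  1ᵣ * x              ≈⟨ *-identityˡ x ⟩
  x                   ∎
  where open SetoidReasoning setoid

average-bits : ∀ {k} {c : Vector ℝ k} (v : Vector ℝ k) → (∀ t → 0ᵣ ≼ c t) → ∑ c ≈ 1ᵣ →
  (∀ t → ∃[ b ] v t ≈ ⟦ b ⟧) → 0ᵣ ≼ ∑ (λ t → c t * v t) × ∑ (λ t → c t * v t) ≼ 1ᵣ
average-bits {k} {c} v 0≼c ∑c≈1 bit =
    ≼-trans (≈⇒≽ (sum-replicate-zero k)) (∑-mono-≼ (λ _ → 0ᵣ) _ λ t → proj₁ (bounds t))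
  , ≼-trans (∑-mono-≼ _ c λ t → proj₂ (bounds t)) (≈⇒≼ ∑c≈1)
  where
  bounds : ∀ t → 0ᵣ ≼ c t * v t × c t * v t ≼ c t
  bounds t with bit t
  ... | true  , v≈1 = let cv≈c = ≈-trans (*-congˡ v≈1) (*-identityʳ (c t)) in
                      ≼-trans (0≼c t) (≈⇒≽ cv≈c) , ≈⇒≼ cv≈c
  ... | false , v≈0 = let cv≈0 = ≈-trans (*-congˡ v≈0) (zeroʳ (c t)) in
                      ≈⇒≽ cv≈0 , ≼-trans (≈⇒≼ cv≈0) (0≼c t)

-- The conditions on `X` concern sums of its entries, which can therefore be evaluated on each
-- generating matrix and averaged afterwards.
sum-of-averages : ∀ {k s} (c : Vector ℝ k) (v : Fin k → Vector ℝ s) (y : Vector ℝ s) →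
  (∀ r → y r ≈ ∑ (λ t → c t * v t r)) → sum y ≈ ∑ (λ t → c t * ∑ (v t))
sum-of-averages c v y y≈ = begin
  sum y                                   ≡⟨ sum≡∑ y ⟩
  ∑ y                                     ≈⟨ sum-cong-≋ y≈ ⟩
  ∑ (λ r → ∑ (λ t → c t * v t r))         ≈⟨ ∑-comm (λ r t → c t * v t r) ⟩
  ∑ (λ t → ∑ (λ r → c t * v t r))         ≈⟨ sum-cong-≋ (λ t → *-distribˡ-sum (c t) (v t)) ⟨
  ∑ (λ t → c t * ∑ (v t))                 ∎
  where open SetoidReasoning setoid

-- With indices from 0, `j ≤ λ_i` becomes `toℕ j < part λ′ (toℕ i)`, and `ν_{i-1} + 1 < j` becomes
-- `part ν k < toℕ j` in row `suc k`.
Inequalities : Partition → Partition → (m n : ℕ) → Matrix m n → Set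
Inequalities λ′ ν m n X =
  (∀ i j → 0ᵣ ≤ᵣ sumUpTo (λ i′ → X i′ j) i × sumUpTo (λ i′ → X i′ j) i ≤ᵣ 1ᵣ) ×
  (∀ i j → 0ᵣ ≤ᵣ sumUpTo (λ j′ → X i j′) j × sumUpTo (λ j′ → X i j′) j ≤ᵣ 1ᵣ) ×
  ((∀ j → toℕ j ≡ 0 → sum (λ i → X i j) ≈ᵣ 1ᵣ) × (∀ i → toℕ i ≡ 0 → sum (λ j → X i j) ≈ᵣ 1ᵣ)) ×
  ((∀ i → 1 ≤ toℕ i → sum (λ j → X i j) ≈ᵣ 0ᵣ) × (∀ j → 1 ≤ toℕ j → sum (λ i → X i j) ≈ᵣ 0ᵣ)) ×
  (∀ i j → toℕ j < part λ′ (toℕ i) → X i j ≈ᵣ 0ᵣ) ×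
  ((∀ i j k → toℕ i ≡ suc k → part ν k < toℕ j → X i j ≈ᵣ 0ᵣ) × (∀ i j → toℕ i ≡ 0 → part ν 0 < toℕ j → X i j ≈ᵣ 0ᵣ))

-- Prefix sums of each generating matrix are 0 or 1, so their averages lie between 0 and 1. Each
-- remaining condition prescribes a value which all generating matrices share.
PASM⇒Inequalities : ∀ m n (λ′ ν : Partition) → ℓ ν ≤ m → part ν 0 ≤ n →
  ∀ {X} → PASM λ′ ν (suc m) (suc n) X → Inequalities λ′ ν (suc m) (suc n) X
PASM⇒Inequalities m n λ′ ν ℓν≤m ν₀≤n {X} (k , c , P , 0≤c , sum-c , P∈ , X≈) =
    (λ i j → toBounds (column-average i j)
      (average-bits _ (λ t → ⟪ 0≤c t ⟫) ∑c≈1 λ t → _ , ≈-trans (∑-inject! (λ i → E t i (toℕ j)) i) (column-sum (μ t) (toℕ i) (toℕ j))))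
  , (λ i j → toBounds (row-average i j)
      (average-bits _ (λ t → ⟪ 0≤c t ⟫) ∑c≈1 λ t →
         let b , eq = row-sum-bit (μ t) (toℕ i) (toℕ j) in b , ≈-trans (∑-inject! (E t (toℕ i)) j) eq))
  , ( (λ j j≡0 → ≈⇒≈ᵣ (≈-trans (sum-of-averages c _ (λ i → X i j) (λ i → X≈′ i j))
         (average-const _ ∑c≈1 λ t → ≈-trans (column-total t j) (at-0 j≡0))))
    , (λ i i≡0 → ≈⇒≈ᵣ (≈-trans (sum-of-averages c _ (X i) (X≈′ i))
         (average-const _ ∑c≈1 λ t → ≈-trans (row-total t i) (top t i≡0)))))
  , ( (λ i 1≤i → ≈⇒≈ᵣ (≈-trans (sum-of-averages c _ (X i) (X≈′ i))
         (average-const _ ∑c≈1 λ t → ≈-trans (row-total t i) (below t 1≤i))))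
    , (λ j 1≤j → ≈⇒≈ᵣ (≈-trans (sum-of-averages c _ (λ i → X i j) (λ i → X≈′ i j))
         (average-const _ ∑c≈1 λ t → ≈-trans (column-total t j) (at-suc 1≤j)))))
  , (λ i j j<λᵢ → ≈⇒≈ᵣ (≈-trans (X≈′ i j) (average-const _ ∑c≈1 λ t → left-of-λ t (toℕ i) (ℕ.<-≤-trans j<λᵢ (λ⊆μ t (toℕ i))))))
  , ( (λ i j h i≡1+h νₕ<j → ≈⇒≈ᵣ (≈-trans (X≈′ i j) (average-const _ ∑c≈1 λ t →
         subst (λ i → E t i (toℕ j) ≈ 0ᵣ) (sym i≡1+h)
           (let μₕ<j = ℕ.≤-<-trans (μ⊆ν t h) νₕ<j in
            entry-off (μ t) h (ℕ.>⇒≢ (ℕ.≤-<-trans (decreasing (μ t) h) μₕ<j)) (ℕ.>⇒≢ μₕ<j)))))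
    , (λ i j i≡0 ν₀<j → ≈⇒≈ᵣ (≈-trans (X≈′ i j) (average-const _ ∑c≈1 λ t →
         subst (λ i → E t i (toℕ j) ≈ 0ᵣ) (sym i≡0) (entry₀-off (μ t) (ℕ.>⇒≢ (ℕ.≤-<-trans (μ⊆ν t 0) ν₀<j)))))))
  where
  open SetoidReasoning setoid

  μ : Fin k → Partition
  μ t = proj₁ (P∈ t)

  λ⊆μ : ∀ t → λ′ ⊆ μ t
  λ⊆μ t = proj₁ (proj₂ (P∈ t))

  μ⊆ν : ∀ t → μ t ⊆ ν
  μ⊆ν t = proj₁ (proj₂ (proj₂ (P∈ t)))

  E : Fin k → ℕ → ℕ → ℝ
  E t = entry (μ t)

  ∑c≈1 : ∑ c ≈ 1ᵣ
  ∑c≈1 = subst (_≈ 1ᵣ) (sum≡∑ c) ⟪ sum-c ⟫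

  X≈′ : ∀ i j → X i j ≈ ∑ (λ t → c t * E t (toℕ i) (toℕ j))
  X≈′ i j = begin
    X i j                                      ≈⟨ ⟪ X≈ i j ⟫ ⟩
    sum (λ t → c t *ᵣ P t i j)                 ≡⟨ sum≡∑ (λ t → c t *ᵣ P t i j) ⟩
    ∑ (λ t → c t *ᵣ P t i j)                   ≡⟨ sum-cong-≗ (λ t → *ᵣ≡* (c t) (P t i j)) ⟩
    ∑ (λ t → c t * P t i j)                    ≈⟨ sum-cong-≋ (λ t → *-congˡ ⟪ proj₂ (proj₂ (proj₂ (P∈ t))) i j ⟫) ⟩
    ∑ (λ t → c t * E t (toℕ i) (toℕ j))        ∎

  toBounds : ∀ {x y} → x ≈ y → 0ᵣ ≼ y × y ≼ 1ᵣ → 0ᵣ ≤ᵣ x × x ≤ᵣ 1ᵣ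
  toBounds x≈y (0≼y , y≼1) = ≼⇒≤ᵣ (≼-trans 0≼y (≈⇒≽ x≈y)) , ≼⇒≤ᵣ (≼-trans (≈⇒≼ x≈y) y≼1)

  column-average : ∀ i j → sumUpTo (λ i′ → X i′ j) i ≈ ∑ (λ t → c t * ∑ (λ r → E t (toℕ (inject! {i = suc i} r)) (toℕ j)))
  column-average i j = sum-of-averages c _ _ λ r → X≈′ (inject! {i = suc i} r) j

  row-average : ∀ i j → sumUpTo (λ j′ → X i j′) j ≈ ∑ (λ t → c t * ∑ (λ r → E t (toℕ i) (toℕ (inject! {i = suc j} r))))
  row-average i j = sum-of-averages c _ _ λ r → X≈′ i (inject! {i = suc j} r)

  -- Row `m` is the last one, so the column totals form the unit vector at `part (μ t) m`, that is,
  -- at column 0.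
  μₘ≡0 : ∀ t → part (μ t) m ≡ 0
  μₘ≡0 t = ℕ.n≤0⇒n≡0 (ℕ.≤-trans (μ⊆ν t m) (ℕ.≤-reflexive (part-beyond-ℓ ν ℓν≤m)))

  column-total : ∀ t (j : Fin (suc n)) → ∑ (λ i → E t (toℕ {suc m} i) (toℕ j)) ≈ ⟦ does (toℕ j ℕ.≟ 0) ⟧
  column-total t j = ≈-trans (∑-toℕ (suc m) (λ i → E t i (toℕ j)))
    (subst (λ a → sumBelow (λ i → E t i (toℕ j)) (suc m) ≈ ⟦ does (toℕ j ℕ.≟ a) ⟧) (μₘ≡0 t) (column-sum (μ t) m (toℕ j)))

  row-total : ∀ t (i : Fin (suc m)) → ∑ (λ j → E t (toℕ i) (toℕ {suc n} j)) ≈ Δ (λ i → corner (μ t) i n) (toℕ i)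
  row-total t i = ≈-trans (∑-toℕ (suc n) (E t (toℕ i))) (row-sum (μ t) (toℕ i) n)

  at-0 : ∀ {j} → j ≡ 0 → ⟦ does (j ℕ.≟ 0) ⟧ ≈ 1ᵣ
  at-0 refl = ≈-refl

  at-suc : ∀ {j} → 1 ≤ j → ⟦ does (j ℕ.≟ 0) ⟧ ≈ 0ᵣ
  at-suc {suc j} _ = ≈-refl

  -- Column `n` is the last one and no part exceeds `n`. The row totals are differences of these
  -- ones: 1 in the top row, 0 below it.
  right-edge : ∀ t i → corner (μ t) i n ≈ 1ᵣ
  right-edge t i = corner-full (μ t) i (ℕ.≤-trans (part-antitone (μ t) z≤n) (ℕ.≤-trans (μ⊆ν t 0) ν₀≤n))

  top : ∀ t {i} → i ≡ 0 → Δ (λ i → corner (μ t) i n) i ≈ 1ᵣ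
  top t refl = right-edge t 0

  below : ∀ t {i} → 1 ≤ i → Δ (λ i → corner (μ t) i n) i ≈ 0ᵣ
  below t {suc i} _ = ≈-trans (-‿cong (right-edge t (suc i)) (right-edge t i)) (x-x≈0 1ᵣ)

  left-of-λ : ∀ t i {j} → j < part (μ t) i → E t i j ≈ 0ᵣ
  left-of-λ t zero    j<μ = entry₀-off (μ t) (ℕ.<⇒≢ j<μ)
  left-of-λ t (suc i) j<μ = entry-off (μ t) i (ℕ.<⇒≢ j<μ) (ℕ.<⇒≢ (ℕ.<-≤-trans j<μ (decreasing (μ t) i)))

-- From subsets of the positions to partitions.

firstTrue : ℕ → (ℕ → Bool) → ℕ
firstTrue zero    u = 0
firstTrue (suc n) u = if u 0 then 0 else suc (firstTrue n (u ∘ suc))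

firstTrue-minimal : ∀ n u {j} → j < firstTrue n u → u j ≡ false
firstTrue-minimal (suc n) u {j} j< with u 0 in u₀
firstTrue-minimal (suc n) u {zero}  j<       | false = u₀
firstTrue-minimal (suc n) u {suc j} (s≤s j<) | false = firstTrue-minimal n (u ∘ suc) j<

firstTrue≤ : ∀ n u {j} → u j ≡ true → firstTrue n u ≤ j
firstTrue≤ n u {j} uj = ℕ.≮⇒≥ λ j< → contradiction (trans (sym uj) (firstTrue-minimal n u j<)) λ ()

firstTrue≤n : ∀ n u → firstTrue n u ≤ n
firstTrue≤n zero    u = z≤n
firstTrue≤n (suc n) u with u 0
... | true  = z≤n
... | false = s≤s (firstTrue≤n n (u ∘ suc))

firstTrue-true : ∀ n u → firstTrue n u < n → u (firstTrue n u) ≡ true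
firstTrue-true (suc n) u f< with u 0 in u₀
firstTrue-true (suc n) u f<       | true  = u₀
firstTrue-true (suc n) u (s≤s f<) | false = firstTrue-true n (u ∘ suc) f<

module _ (n : ℕ) .{{_ : ℕ.NonZero n}} where

  index : ℕ → ℕ → ℕ
  index i j = j ℕ.+ i ℕ.* n

  index<m*n : ∀ {m i j} → i < m → j < n → index i j < m ℕ.* n
  index<m*n {m} {i} {j} i<m j<n = ℕ.<-≤-trans (ℕ.+-monoˡ-< (i ℕ.* n) j<n) (ℕ.*-monoˡ-≤ n i<m)

  m*n≤index : ∀ {m i} j → m ≤ i → m ℕ.* n ≤ index i j
  m*n≤index {m} {i} j m≤i = ℕ.≤-trans (ℕ.*-monoˡ-≤ n m≤i) (ℕ.m≤n+m (i ℕ.* n) j)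

  index/n≡i : ∀ i {j} → j < n → index i j / n ≡ i
  index/n≡i i {j} j<n = trans (+-distrib-/-∣ʳ j (divides-refl i)) (cong₂ ℕ._+_ (m<n⇒m/n≡0 j<n) (m*n/n≡m i n))

  index%n≡j : ∀ i {j} → j < n → index i j % n ≡ j
  index%n≡j i {j} j<n = trans ([m+kn]%n≡m%n j i n) (m<n⇒m%n≡m j<n)

true≢false : ∀ {b} → b ≡ true → b ≢ false
true≢false refl ()

module Decomposition
  (m n : ℕ) (λ′ ν : Partition) (λ⊆ν : λ′ ⊆ ν) (νₘ≡0 : part ν m ≡ 0) (λ₀≤n : part λ′ 0 ≤ n)
  (F : ℕ → ℕ → ℝ)
  (0≼F : ∀ {i j} → i < suc m → j < suc n → 0ᵣ ≼ F i j)
  (F≼1 : ∀ {i j} → i < suc m → j < suc n → F i j ≼ 1ᵣ)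
  (F-mono : ∀ {i i′ j j′} → i ≤ i′ → i′ < suc m → j ≤ j′ → j′ < suc n → F i j ≼ F i′ j′)
  (F≼0 : ∀ {i j} → i < suc m → j < suc n → j < part λ′ i → F i j ≼ 0ᵣ)
  (1≼F : ∀ {i j} → i < suc m → j < suc n → part ν i ≤ j → 1ᵣ ≼ F i j)
  where

  N : ℕ
  N = suc m ℕ.* suc n

  row column : ℕ → ℕ
  row p    = p / suc n
  column p = p % suc n

  x : ℕ → ℝ
  x p = F (row p) (column p)

  row< : ∀ {p} → p < N → row p < suc m
  row< = m<n*o⇒m/o<n

  column< : ∀ p → column p < suc n
  column< p = m%n<n p (suc n)

  -- The three ways to fail to be `{(i, j) : μ_i ≤ j}` with `λ′ ⊆ μ ⊆ ν`. They conflict with `F≼0`,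
  -- `1≼F` and `F-mono` respectively, and mention only Booleans and natural numbers, so a bounded
  -- search decides them.
  LeftOfλ Unsaturated Inversion : (ℕ → Bool) → Set
  LeftOfλ u     = ∃[ p ] p < N × u p ≡ true × column p < part λ′ (row p)
  Unsaturated u = ∃[ q ] q < N × u q ≡ false × part ν (row q) ≤ column q
  Inversion u   = ∃[ p ] p < N × u p ≡ true ×
                  ∃[ q ] q < N × u q ≡ false × row p ≤ row q × column p ≤ column q

  Improper : (ℕ → Bool) → Set
  Improper u = LeftOfλ u ⊎ Unsaturated u ⊎ Inversion u

  improper? : ∀ u → Dec (Improper u)
  improper? u =
    ℕ.anyUpTo? (λ p → (u p Bool.≟ true) ×-dec (column p ℕ.<? part λ′ (row p))) N ⊎-dec
    ℕ.anyUpTo? (λ q → (u q Bool.≟ false) ×-dec (part ν (row q) ℕ.≤? column q)) N ⊎-dec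
    ℕ.anyUpTo? (λ p → (u p Bool.≟ true) ×-dec
      ℕ.anyUpTo? (λ q → (u q Bool.≟ false) ×-dec (row p ℕ.≤? row q) ×-dec (column p ℕ.≤? column q)) N) N

  improper⇒weight≈0 : ∀ u → Improper u → weight N x 0ᵣ 1ᵣ u ≈ 0ᵣ
  improper⇒weight≈0 u (inj₁ (p , p<N , up , p<λ)) =
    weight-member≼lower N x 0ᵣ 1ᵣ u p<N up (F≼0 (row< p<N) (column< p) p<λ)
  improper⇒weight≈0 u (inj₂ (inj₁ (q , q<N , uq , ν≤q))) =
    weight-upper≼nonMember N x 0ᵣ 1ᵣ u q<N uq (1≼F (row< q<N) (column< q) ν≤q)
  improper⇒weight≈0 u (inj₂ (inj₂ (p , p<N , up , q , q<N , uq , rows , columns))) =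
    weight-member≼nonMember N x 0ᵣ 1ᵣ u p<N q<N up uq (F-mono rows (row< q<N) columns (column< q))

  module Proper (u : ℕ → Bool) (u-beyond : ∀ {p} → N ≤ p → u p ≡ true) (proper : ¬ Improper u) where

    U : ℕ → ℕ → Bool
    U i j = u (index (suc n) i j)

    module _ {i j : ℕ} (i<m : i < suc m) (j<n : j < suc n) where
      p<N : index (suc n) i j < N
      p<N = index<m*n (suc n) i<m j<n

      row≡ : row (index (suc n) i j) ≡ i
      row≡ = index/n≡i (suc n) i j<n

      column≡ : column (index (suc n) i j) ≡ j
      column≡ = index%n≡j (suc n) i j<n

      U-left : j < part λ′ i → U i j ≡ false
      U-left j<λ with U i j in eq
      ... | false = refl
      ... | true = contradiction
        (inj₁ (_ , p<N , eq , ℕ.≤-trans (s≤s (ℕ.≤-reflexive column≡)) (subst (λ i → j < part λ′ i) (sym row≡) j<λ))) proper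

      U-right : part ν i ≤ j → U i j ≡ true
      U-right ν≤j with U i j in eq
      ... | true = refl
      ... | false = contradiction
        (inj₂ (inj₁ (_ , p<N , eq , ℕ.≤-trans (subst (λ i → part ν i ≤ j) (sym row≡) ν≤j) (ℕ.≤-reflexive (sym column≡))))) proper

    U-mono : ∀ {i j i′ j′} → i ≤ i′ → i′ < suc m → j ≤ j′ → j′ < suc n → U i j ≡ true → U i′ j′ ≡ true
    U-mono {i} {j} {i′} {j′} i≤i′ i′<m j≤j′ j′<n Uij with U i′ j′ in eq
    ... | true = refl
    ... | false = contradiction (inj₂ (inj₂ (_ , p<N i<m j<n , Uij , _ , p<N i′<m j′<n , eq
        , ℕ.≤-trans (ℕ.≤-reflexive (row≡ i<m j<n)) (ℕ.≤-trans i≤i′ (ℕ.≤-reflexive (sym (row≡ i′<m j′<n))))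
        , ℕ.≤-trans (ℕ.≤-reflexive (column≡ i<m j<n)) (ℕ.≤-trans j≤j′ (ℕ.≤-reflexive (sym (column≡ i′<m j′<n))))))) proper
      where
      i<m = ℕ.≤-<-trans i≤i′ i′<m
      j<n = ℕ.≤-<-trans j≤j′ j′<n

    U-beyond : ∀ {i} j → m < i → U i j ≡ true
    U-beyond j m<i = u-beyond (m*n≤index (suc n) j m<i)

    first : ℕ → ℕ
    first i = firstTrue (suc n) (U i)

    first-beyond : ∀ {i} → m < i → first i ≡ 0
    first-beyond {i} m<i = ℕ.n≤0⇒n≡0 (firstTrue≤ (suc n) (U i) (U-beyond 0 m<i))

    -- Membership passes down a column, so the first member of row `i` has a member below it. A row
    -- without members takes the default `suc n`, the largest value possible; rows below the matrix
    -- take 0.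
    first-decreasing : ∀ i → first (suc i) ≤ first i
    first-decreasing i with suc i ℕ.<? suc m | first i ℕ.<? suc n
    ... | no i≮m  | _ = ℕ.≤-trans (ℕ.≤-reflexive (first-beyond (ℕ.≮⇒≥ i≮m))) z≤n
    ... | yes _   | no ≮n = ℕ.≤-trans (firstTrue≤n (suc n) (U (suc i))) (ℕ.≮⇒≥ ≮n)
    ... | yes i<m | yes <n = firstTrue≤ (suc n) (U (suc i))
      (U-mono (ℕ.n≤1+n i) i<m ℕ.≤-refl <n (firstTrue-true (suc n) (U i) <n))

    -- A proper `U` is closed under moving right, so in each row the non-members form an initial
    -- segment; its length is the part.
    μ : Partition
    μ = record
      { part          = first
      ; decreasing    = first-decreasing
      ; finiteSupport = suc m , λ i m<i → first-beyond m<i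
      }

    λ⊆μ : λ′ ⊆ μ
    λ⊆μ i with i ℕ.<? suc m
    -- Below the last row, `λ_i ≤ ν_i ≤ ν_m = 0`.
    ... | no i≮m = ℕ.≤-trans (ℕ.≤-trans (λ⊆ν i) (ℕ.≤-trans (part-antitone ν (ℕ.≤-trans (ℕ.n≤1+n m) (ℕ.≮⇒≥ i≮m))) (ℕ.≤-reflexive νₘ≡0))) z≤n
    ... | yes i<m = ℕ.≮⇒≥ λ first<λ →
      -- The bound `λ₀≤n` shows that `first i` is a column of the matrix and not the default, hence
      -- a member of `U` to the left of `λ′`.
      let first<n = ℕ.<-≤-trans first<λ (ℕ.≤-trans (part-antitone λ′ z≤n) (ℕ.≤-trans λ₀≤n (ℕ.n≤1+n n))) in
      true≢false (firstTrue-true (suc n) (U i) first<n) (U-left i<m first<n first<λ)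

    μ⊆ν : μ ⊆ ν
    μ⊆ν i with i ℕ.<? suc m | part ν i ℕ.<? suc n
    ... | no i≮m  | _ = ℕ.≤-trans (ℕ.≤-reflexive (first-beyond (ℕ.≮⇒≥ i≮m))) z≤n
    ... | yes i<m | yes ν<n = firstTrue≤ (suc n) (U i) (U-right i<m ν<n ℕ.≤-refl)
    ... | yes _   | no ν≮n = ℕ.≤-trans (firstTrue≤n (suc n) (U i)) (ℕ.≮⇒≥ ν≮n)

    corner-μ : ∀ {i j} → i < suc m → j < suc n → corner μ i j ≡ ⟦ U i j ⟧
    corner-μ {i} {j} i<m j<n with first i ℕ.≤? j
    ... | yes ≤j rewrite dec-true (first i ℕ.≤? j) ≤j
        | U-mono {i} {first i} {i} {j} ℕ.≤-refl i<m ≤j j<n (firstTrue-true (suc n) (U i) (ℕ.≤-<-trans ≤j j<n)) = refl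
    ... | no ≰j rewrite dec-false (first i ℕ.≤? j) ≰j | firstTrue-minimal (suc n) (U i) (ℕ.≰⇒> ≰j) = refl

  u : Fin (2 ^ N) → ℕ → Bool
  u = subsets N

  c : Vector ℝ (2 ^ N)
  c t = weight N x 0ᵣ 1ᵣ (u t)

  0≼c : ∀ t → 0ᵣ ≼ c t
  0≼c t = 0≼gap _ _

  ∑c≈1 : ∑ c ≈ 1ᵣ
  ∑c≈1 = ≈-trans (sum-weight N x 0ᵣ 1ᵣ) (≈-trans (gap-congʳ 1≈1⊓1) (gap-unit 0≼1 ≼-refl))
    where
    0≼1 : 0ᵣ ≼ 1ᵣ
    0≼1 = ≼-trans (0≼F {0} {0} z<s z<s) (F≼1 z<s z<s)
    1≈1⊓1 : 1ᵣ ≈ 1ᵣ ⊓ 1ᵣ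
    1≈1⊓1 = ≼-antisym (⊓-glb ≼-refl ≼-refl) (x⊓y≼x 1ᵣ 1ᵣ)

  -- The factor `c t` lets the identity cover improper subsets too: there the corner sums need not
  -- match the subset, but the weight vanishes.
  member : ∀ t → Σ[ μ ∈ Partition ] λ′ ⊆ μ × μ ⊆ ν ×
    (∀ {i j} → i < suc m → j < suc n → c t * corner μ i j ≈ c t * ⟦ u t (index (suc n) i j) ⟧)
  member t with improper? (u t)
  -- A placeholder: some partition between `λ′` and `ν` must accompany the coefficient 0.
  ... | yes improper = λ′ , (λ _ → ℕ.≤-refl) , λ⊆ν , λ i<m j<n →
    let c≈0 = improper⇒weight≈0 (u t) improper in
    ≈-trans (≈-trans (*-congʳ c≈0) (zeroˡ _)) (≈-sym (≈-trans (*-congʳ c≈0) (zeroˡ _)))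
  ... | no proper = μ , λ⊆μ , μ⊆ν , λ {i} {j} i<m j<n →
    subst (λ y → c t * corner μ i j ≈ c t * y) (corner-μ i<m j<n) ≈-refl
    where open Proper (u t) (subsets-beyond N t) proper

  corner-average : ∀ {i j} → i < suc m → j < suc n → ∑ (λ t → c t * corner (proj₁ (member t)) i j) ≈ F i j
  corner-average {i} {j} i<m j<n = begin
    ∑ (λ t → c t * corner (proj₁ (member t)) i j)      ≈⟨ sum-cong-≋ {2 ^ N} (λ t → proj₂ (proj₂ (proj₂ (member t))) i<m j<n) ⟩
    ∑ (λ t → c t * ⟦ u t p ⟧)                          ≈⟨ sum-weight-member N x 0ᵣ 1ᵣ (index<m*n (suc n) i<m j<n) ⟩
    gap 0ᵣ (1ᵣ ⊓ x p)                                  ≡⟨ cong₂ (λ i j → gap 0ᵣ (1ᵣ ⊓ F i j)) (index/n≡i (suc n) i j<n) (index%n≡j (suc n) i j<n) ⟩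
    gap 0ᵣ (1ᵣ ⊓ F i j)                                ≈⟨ gap-unit (0≼F i<m j<n) (F≼1 i<m j<n) ⟩
    F i j                                              ∎
    where
    open SetoidReasoning setoid
    p = index (suc n) i j

  -- Averaging is linear and commutes with the difference in either index, so the agreement of the
  -- corner sums carries over to the entries.
  entry-average : ∀ {i j} → i < suc m → j < suc n →
    ∑ (λ t → c t * entry (proj₁ (member t)) i j) ≈ Δ (λ i → Δ (F i) j) i
  entry-average {i} {j} i<m j<n = begin
    ∑ (λ t → c t * entry (μ t) i j)                               ≈⟨ sum-cong-≋ {2 ^ N} (λ t → *-congˡ (entry≈ΔΔcorner (μ t) i j)) ⟩
    ∑ (λ t → c t * Δ (λ i → Δ (corner (μ t) i) j) i)              ≈⟨ sum-cong-≋ {2 ^ N} (λ t → *-Δ (c t) (λ i → Δ (corner (μ t) i) j) i) ⟩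
    ∑ (λ t → Δ (λ i → c t * Δ (corner (μ t) i) j) i)              ≈⟨ ∑-Δ {2 ^ N} (λ t i → c t * Δ (corner (μ t) i) j) i ⟩
    Δ (λ i → ∑ (λ t → c t * Δ (corner (μ t) i) j)) i              ≈⟨ Δ-cong i (λ i′≤i → columnwise (ℕ.≤-<-trans i′≤i i<m)) ⟩
    Δ (λ i → Δ (F i) j) i                                         ∎
    where
    open SetoidReasoning setoid
    μ : Fin (2 ^ N) → Partition
    μ t = proj₁ (member t)
    columnwise : ∀ {i} → i < suc m → ∑ (λ t → c t * Δ (corner (μ t) i) j) ≈ Δ (F i) j
    columnwise {i} i<m = begin
      ∑ (λ t → c t * Δ (corner (μ t) i) j)        ≈⟨ sum-cong-≋ {2 ^ N} (λ t → *-Δ (c t) (corner (μ t) i) j) ⟩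
      ∑ (λ t → Δ (λ j → c t * corner (μ t) i j) j) ≈⟨ ∑-Δ {2 ^ N} (λ t j → c t * corner (μ t) i j) j ⟩
      Δ (λ j → ∑ (λ t → c t * corner (μ t) i j)) j ≈⟨ Δ-cong j (λ j′≤j → corner-average i<m (ℕ.≤-<-trans j′≤j j<n)) ⟩
      Δ (F i) j                                    ∎

-- From the inequalities to the convex hull.

extend : ∀ {n} → Vector ℝ n → ℕ → ℝ
extend {zero}  f _       = 0ᵣ
extend {suc n} f zero    = f zero
extend {suc n} f (suc p) = extend (f ∘ suc) p

extend-toℕ : ∀ {n} (f : Vector ℝ n) i → extend f (toℕ i) ≡ f i
extend-toℕ f zero    = refl
extend-toℕ f (suc i) = extend-toℕ (f ∘ suc) i

Inequalities⇒PASM : ∀ m n (λ′ ν : Partition) → λ′ ⊆ ν → ℓ ν ≤ m → part λ′ 0 ≤ n →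
  ∀ {X} → Inequalities λ′ ν (suc m) (suc n) X → PASM λ′ ν (suc m) (suc n) X
Inequalities⇒PASM m n λ′ ν λ⊆ν ℓν≤m λ₀≤n {X}
  (columns , rows , (_ , row₀≈1) , (row≈0 , column≈0) , leftOfλ≈0 , rightOfν≈0 , _) =
    2 ^ N , c , (λ t → partitionMatrix (proj₁ (member t)) (suc m) (suc n))
  , (λ t → ≼⇒≤ᵣ (0≼c t))
  , ≈⇒≈ᵣ (subst (_≈ 1ᵣ) (sym (sum≡∑ c)) ∑c≈1)
  , (λ t → proj₁ (member t) , proj₁ (proj₂ (member t)) , proj₁ (proj₂ (proj₂ (member t))) , λ i j → ≈⇒≈ᵣ (≈-refl {entry (proj₁ (member t)) (toℕ i) (toℕ j)}))
  , λ i j → ≈⇒≈ᵣ (begin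
      X i j                                                         ≡⟨ Y-toℕ i j ⟨
      Y (toℕ i) (toℕ j)                                             ≈⟨ ΔΔF≈Y (toℕ i) (toℕ j) ⟨
      Δ (λ i → Δ (F i) (toℕ j)) (toℕ i)                             ≈⟨ entry-average (toℕ<n i) (toℕ<n j) ⟨
      ∑ (λ t → c t * E t (toℕ i) (toℕ j))                           ≡⟨ sum-cong-≗ {2 ^ N} (λ t → *ᵣ≡* (c t) (E t (toℕ i) (toℕ j))) ⟨
      ∑ (λ t → c t *ᵣ E t (toℕ i) (toℕ j))                          ≡⟨ sum≡∑ (λ t → c t *ᵣ E t (toℕ i) (toℕ j)) ⟨
      sum (λ t → c t *ᵣ E t (toℕ i) (toℕ j))                        ∎)
  where
  open SetoidReasoning setoid

  Y : ℕ → ℕ → ℝ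
  Y i j = extend (λ i → extend (X i) j) i

  Y-toℕ : ∀ i j → Y (toℕ i) (toℕ j) ≡ X i j
  Y-toℕ i j = trans (extend-toℕ (λ i → extend (X i) (toℕ j)) i) (extend-toℕ (X i) j)

  C R F : ℕ → ℕ → ℝ
  C i j = sumBelow (λ i → Y i j) (suc i)
  R i j = sumBelow (Y i) (suc j)
  F i j = sumBelow (C i) (suc j)

  F≈ : ∀ i j → F i j ≈ sumBelow (λ i → R i j) (suc i)
  F≈ i j = sumBelow-comm (λ j i → Y i j) (suc j) (suc i)

  ΔΔF≈Y : ∀ i j → Δ (λ i → Δ (F i) j) i ≈ Y i j
  ΔΔF≈Y i j = ≈-trans (Δ-cong i (λ {i} _ → Δ-sumBelow (C i) j)) (Δ-sumBelow (λ i → Y i j) i)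

  at : ∀ {n} (P : ℕ → Set) → (∀ (i : Fin n) → P (toℕ i)) → ∀ {i} → i < n → P i
  at P p i<n = subst P (toℕ-fromℕ< i<n) (p (fromℕ< i<n))

  column-prefix : ∀ i j → sumUpTo (λ i′ → X i′ j) i ≈ C (toℕ i) (toℕ j)
  column-prefix i j = begin
    sumUpTo (λ i′ → X i′ j) i                                      ≡⟨ sum≡∑ (λ r → X (inject! {i = suc i} r) j) ⟩
    ∑ (λ r → X (inject! {i = suc i} r) j)                          ≡⟨ sum-cong-≗ {suc (toℕ i)} (λ r → Y-toℕ (inject! {i = suc i} r) j) ⟨
    ∑ (λ r → Y (toℕ (inject! {i = suc i} r)) (toℕ j))              ≈⟨ ∑-inject! (λ i → Y i (toℕ j)) i ⟩
    C (toℕ i) (toℕ j)                                              ∎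

  row-prefix : ∀ i j → sumUpTo (X i) j ≈ R (toℕ i) (toℕ j)
  row-prefix i j = begin
    sumUpTo (X i) j                                                ≡⟨ sum≡∑ (λ r → X i (inject! {i = suc j} r)) ⟩
    ∑ (λ r → X i (inject! {i = suc j} r))                          ≡⟨ sum-cong-≗ {suc (toℕ j)} (λ r → Y-toℕ i (inject! {i = suc j} r)) ⟨
    ∑ (λ r → Y (toℕ i) (toℕ (inject! {i = suc j} r)))              ≈⟨ ∑-inject! (Y (toℕ i)) j ⟩
    R (toℕ i) (toℕ j)                                              ∎

  column-total : ∀ j → sum (λ i → X i j) ≈ C m (toℕ j)
  column-total j = begin
    sum (λ i → X i j)                     ≡⟨ sum≡∑ (λ i → X i j) ⟩
    ∑ (λ i → X i j)                       ≡⟨ sum-cong-≗ {suc m} (λ i → Y-toℕ i j) ⟨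
    ∑ {suc m} (λ i → Y (toℕ i) (toℕ j))   ≈⟨ ∑-toℕ (suc m) (λ i → Y i (toℕ j)) ⟩
    C m (toℕ j)                           ∎

  row-total : ∀ i → sum (X i) ≈ R (toℕ i) n
  row-total i = begin
    sum (X i)                             ≡⟨ sum≡∑ (X i) ⟩
    ∑ (X i)                               ≡⟨ sum-cong-≗ {suc n} (λ j → Y-toℕ i j) ⟨
    ∑ {suc n} (λ j → Y (toℕ i) (toℕ j))   ≈⟨ ∑-toℕ (suc n) (Y (toℕ i)) ⟩
    R (toℕ i) n                           ∎

  0≼C : ∀ {i j} → i < suc m → j < suc n → 0ᵣ ≼ C i j
  0≼C {j = j} i<m j<n = at (λ i → 0ᵣ ≼ C i j) (λ i → at (λ j → 0ᵣ ≼ C (toℕ i) j)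
    (λ j → ≼-trans ⟪ proj₁ (columns i j) ⟫ (≈⇒≼ (column-prefix i j))) j<n) i<m

  0≼R : ∀ {i j} → i < suc m → j < suc n → 0ᵣ ≼ R i j
  0≼R {j = j} i<m j<n = at (λ i → 0ᵣ ≼ R i j) (λ i → at (λ j → 0ᵣ ≼ R (toℕ i) j)
    (λ j → ≼-trans ⟪ proj₁ (rows i j) ⟫ (≈⇒≼ (row-prefix i j))) j<n) i<m

  Rₙ≈0 : ∀ {i} → i < suc m → 1 ≤ i → R i n ≈ 0ᵣ
  Rₙ≈0 = at (λ i → 1 ≤ i → R i n ≈ 0ᵣ) λ i 1≤i → ≈-trans (≈-sym (row-total i)) ⟪ row≈0 i 1≤i ⟫

  Cₘ≈0 : ∀ {j} → j < suc n → 1 ≤ j → C m j ≈ 0ᵣ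
  Cₘ≈0 = at (λ j → 1 ≤ j → C m j ≈ 0ᵣ) λ j 1≤j → ≈-trans (≈-sym (column-total j)) ⟪ column≈0 j 1≤j ⟫

  Y-left : ∀ {i j} → i < suc m → j < suc n → j < part λ′ i → Y i j ≈ 0ᵣ
  Y-left {j = j} i<m j<n = at (λ i → j < part λ′ i → Y i j ≈ 0ᵣ) (λ i →
    at (λ j → j < part λ′ (toℕ i) → Y (toℕ i) j ≈ 0ᵣ)
      (λ j j<λ → subst (_≈ 0ᵣ) (sym (Y-toℕ i j)) ⟪ leftOfλ≈0 i j j<λ ⟫) j<n) i<m

  Y-right : ∀ {i j k} → i < suc m → j < suc n → i ≡ suc k → part ν k < j → Y i j ≈ 0ᵣ
  Y-right {j = j} {k} i<m j<n = at (λ i → i ≡ suc k → part ν k < j → Y i j ≈ 0ᵣ) (λ i →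
    at (λ j → toℕ i ≡ suc k → part ν k < j → Y (toℕ i) j ≈ 0ᵣ)
      (λ j i≡1+k ν<j → subst (_≈ 0ᵣ) (sym (Y-toℕ i j)) ⟪ rightOfν≈0 i j k i≡1+k ν<j ⟫) j<n) i<m

  -- Moving right adds column prefix sums, which condition (1) makes nonnegative. Moving down, after
  -- the order of summation is exchanged, adds row prefix sums, nonnegative by condition (2).
  F-mono : ∀ {i i′ j j′} → i ≤ i′ → i′ < suc m → j ≤ j′ → j′ < suc n → F i j ≼ F i′ j′
  F-mono {i} {i′} {j} {j′} i≤i′ i′<m j≤j′ j′<n = ≼-trans
    (sumBelow-extend-≼ (C i) (s≤s j≤j′) λ _ k≤j′ → 0≼C (ℕ.≤-<-trans i≤i′ i′<m) (ℕ.<-≤-trans k≤j′ j′<n))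
    (≼-trans (≈⇒≼ (F≈ i j′)) (≼-trans
      (sumBelow-extend-≼ (λ i → R i j′) (s≤s i≤i′) λ _ k≤i′ → 0≼R (ℕ.<-≤-trans k≤i′ i′<m) j′<n)
      (≈⇒≽ (F≈ i′ j′))))

  0≼F : ∀ {i j} → i < suc m → j < suc n → 0ᵣ ≼ F i j
  0≼F {i} {j} i<m j<n = sumBelow-extend-≼ (C i) {0} z≤n λ _ k≤j → 0≼C i<m (ℕ.<-≤-trans k≤j j<n)

  -- In the last column `F` adds up row totals, and only the top row has a nonzero one.
  Fₙ≈1 : ∀ {i} → i < suc m → F i n ≈ 1ᵣ
  Fₙ≈1 {i} i<m = begin
    F i n                       ≈⟨ F≈ i n ⟩
    sumBelow (λ i → R i n) (suc i)     ≈⟨ sumBelow-extend-≈ (λ i → R i n) {1} (s≤s z≤n) (λ 1≤k k≤i → Rₙ≈0 (ℕ.<-≤-trans k≤i i<m) 1≤k) ⟨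
    0ᵣ + R 0 n                  ≈⟨ +-identityˡ (R 0 n) ⟩
    R 0 n                       ≈⟨ row-total zero ⟨
    sum (X zero)                ≈⟨ ⟪ row₀≈1 zero refl ⟫ ⟩
    1ᵣ                          ∎

  F≼1 : ∀ {i j} → i < suc m → j < suc n → F i j ≼ 1ᵣ
  F≼1 i<m j<n = ≼-trans (F-mono ℕ.≤-refl i<m (ℕ.≤-pred j<n) ℕ.≤-refl) (≈⇒≼ (Fₙ≈1 i<m))

  -- Every entry summed is 0: for `i′ ≤ i` and `j′ ≤ j`, `j′ ≤ j < λ_i ≤ λ_{i′}`.
  F≼0 : ∀ {i j} → i < suc m → j < suc n → j < part λ′ i → F i j ≼ 0ᵣ
  F≼0 {i} {j} i<m j<n j<λ = ≈⇒≽ (sumBelow-extend-≈ (C i) {0} z≤n λ {j′} _ j′≤j →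
    ≈-sym (sumBelow-extend-≈ (λ i → Y i j′) {0} z≤n λ _ i′≤i →
      Y-left (ℕ.<-≤-trans i′≤i i<m) (ℕ.<-≤-trans j′≤j j<n)
        (ℕ.<-≤-trans (ℕ.≤-<-trans (ℕ.≤-pred j′≤j) j<λ) (part-antitone λ′ (ℕ.≤-pred i′≤i)))))

  -- The columns `j′ > j` contribute nothing, so `F i j` equals `F i n`. Indeed a row `suc k` below
  -- row `i` has `ν_k ≤ ν_i ≤ j < j′`, hence a zero in column `j′`; so the prefix sum of that column
  -- up to row `i` is already its total, which is 0 because `j′ ≥ 1`.
  1≼F : ∀ {i j} → i < suc m → j < suc n → part ν i ≤ j → 1ᵣ ≼ F i j
  1≼F {i} {j} i<m j<n ν≤j = ≼-trans (≈⇒≽ (Fₙ≈1 i<m)) (≈⇒≽ (sumBelow-extend-≈ (C i) j<n λ {j′} j<j′ j′<n →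
    ≈-trans
      (sumBelow-extend-≈ (λ i → Y i j′) i<m λ { {suc k} i<k k<m → Y-right k<m j′<n refl
        (ℕ.≤-<-trans (ℕ.≤-trans (part-antitone ν (ℕ.≤-pred i<k)) ν≤j) j<j′) })
      (Cₘ≈0 j′<n (ℕ.≤-trans z<s j<j′))))

  open Decomposition m n λ′ ν λ⊆ν (part-beyond-ℓ ν ℓν≤m) λ₀≤n F 0≼F F≼1 F-mono F≼0 1≼F

  E : Fin (2 ^ N) → ℕ → ℕ → ℝ
  E t = entry (proj₁ (member t))

theorem1 : (m n : ℕ) → 1 ≤ m → 1 ≤ n →
    (λ′ ν : Partition) → λ′ ⊆ ν →
    InRectangle (n ∸ 1) (m ∸ 1) λ′ → InRectangle (n ∸ 1) (m ∸ 1) ν →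
    PASM λ′ ν m n ≐ (λ (X : Matrix m n) →
    (∀ i j → 0ᵣ ≤ᵣ sumUpTo (λ i′ → X i′ j) i × sumUpTo (λ i′ → X i′ j) i ≤ᵣ 1ᵣ) ×
    (∀ i j → 0ᵣ ≤ᵣ sumUpTo (λ j′ → X i j′) j × sumUpTo (λ j′ → X i j′) j ≤ᵣ 1ᵣ) ×
    ((∀ j → toℕ j ≡ 0 → sum (λ i → X i j) ≈ᵣ 1ᵣ) × (∀ i → toℕ i ≡ 0 → sum (λ j → X i j) ≈ᵣ 1ᵣ)) ×
    ((∀ i → 1 ≤ toℕ i → sum (λ j → X i j) ≈ᵣ 0ᵣ) × (∀ j → 1 ≤ toℕ j → sum (λ i → X i j) ≈ᵣ 0ᵣ)) ×
    (∀ i j → toℕ j < part λ′ (toℕ i) → X i j ≈ᵣ 0ᵣ) ×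
    ((∀ i j k → toℕ i ≡ suc k → part ν k < toℕ j → X i j ≈ᵣ 0ᵣ) × (∀ i j → toℕ i ≡ 0 → part ν 0 < toℕ j → X i j ≈ᵣ 0ᵣ)))
theorem1 (suc m) (suc n) _ _ λ′ ν λ⊆ν (_ , λ₀≤n) (ℓν≤m , ν₀≤n) =
  (λ {X} → PASM⇒Inequalities m n λ′ ν ℓν≤m ν₀≤n {X}) ,
  (λ {X} → Inequalities⇒PASM m n λ′ ν λ⊆ν ℓν≤m λ₀≤n {X})
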